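{- There exist a constant $c > 0$ and a positive integer $N$ such that every finite metric space $(V,\rho)$ with $|V| \ge N$ that has no universal line has at least $c\,|V|^{2/3}$ distinct lines.
   Context: In a metric space $(V,\rho)$, for every pair of distinct points $a,b\in V$, the line $\overline{ab}$ is the set of all $x\in V$ such that $\rho(x,b)=\rho(x,a)+\rho(a,b)$ or $\rho(a,b)=\rho(a,x)+\rho(x,b)$ or $\rho(a,x)=\rho(a,b)+\rho(b,x)$. The lines of $(V,\rho)$ are the sets $\overline{ab}$ with $a \neq b$ in $V$; two lines are distinct if they are different as subsets of $V$. A universal line is a line equal to $V$. -}

module Defs where

open import Data.Empty using (⊥-elim)
open import Data.Fin.Base using (Fin)
import Data.Integer.Base as ℤ
import Data.Integer.Properties as ℤ
open import Data.Nat.Base as ℕ using (ℕ; zero; suc; _⊔_)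
import Data.Nat.Properties as ℕ
import Data.Nat.Tactic.RingSolver as ℕSolver
open import Data.Product.Base using (∃; ∃-syntax; ∃₂; _×_; _,_; proj₁; proj₂)
open import Data.Rational.Base as ℚ using (ℚ; mkℚ; 0ℚ; 1ℚ; ½; _/_; _+_; _*_; _-_; -_; ∣_∣; _≤_; _<_)
open import Data.Rational.Properties as ℚ using (≤-trans; ≤-reflexive; module ≤-Reasoning)
open import Data.Rational.Solver using (module +-*-Solver)
open import Data.Rational.Unnormalised.Base as ℚᵘ using (ℚᵘ; mkℚᵘ)
import Data.Rational.Unnormalised.Properties as ℚᵘ
open import Data.Sum.Base using (_⊎_; inj₁; inj₂)
open import Function.Metric.Structures using (IsGeneralMetric)
open import Level using (0ℓ)
open import Relation.Binary.PropositionalEquality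
  using (_≡_; _≢_; refl; sym; trans; cong; cong₂; subst)
open import Relation.Binary.Structures using (IsEquivalence; IsPartialOrder)
open import Relation.Nullary using (¬_; yes; no)
open import Relation.Unary using (Pred; U; _≐_)

Eventually : (ℕ → Set) → Set
Eventually P = ∃[ N ] (∀ n → N ℕ.≤ n → P n)

eventually-map : ∀ {P Q : ℕ → Set} → (∀ {n} → P n → Q n) → Eventually P → Eventually Q
eventually-map f (N , p) = N , λ n N≤n → f (p n N≤n)

eventually-zip : ∀ {P Q R : ℕ → Set} → (∀ {n} → P n → Q n → R n) →
                 Eventually P → Eventually Q → Eventually R
eventually-zip f (M , p) (N , q) = M ⊔ N , λ n le →
  f (p n (ℕ.≤-trans (ℕ.m≤m⊔n M N) le)) (q n (ℕ.≤-trans (ℕ.m≤n⊔m M N) le))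

always : ∀ {P : ℕ → Set} → (∀ n → P n) → Eventually P
always p = 0 , λ n _ → p n

IsCauchy : (ℕ → ℚ) → Set
IsCauchy s = ∀ ε → 0ℚ < ε → ∃[ N ] (∀ m n → N ℕ.≤ m → N ℕ.≤ n → ∣ s m - s n ∣ ≤ ε)

+-swap : ∀ a b → b + (a - b) ≡ a
+-swap = solve 2 (λ a b → b :+ (a :+ :- b) := a) refl
  where open +-*-Solver

+-swap′ : ∀ b e → (b + e) - b ≡ e
+-swap′ = solve 2 (λ b e → (b :+ e) :+ :- b := e) refl
  where open +-*-Solver

neg-sub : ∀ a b → - (a - b) ≡ b - a
neg-sub = solve 2 (λ a b → :- (a :+ :- b) := b :+ :- a) refl
  where open +-*-Solver

p≤∣p∣ : ∀ p → p ≤ ∣ p ∣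
p≤∣p∣ p with ℚ.≤-total 0ℚ p
... | inj₁ 0≤p = ≤-reflexive (sym (ℚ.0≤p⇒∣p∣≡p 0≤p))
... | inj₂ p≤0 = ≤-trans p≤0 (ℚ.0≤∣p∣ p)

∣-∣-comm : ∀ a b → ∣ a - b ∣ ≡ ∣ b - a ∣
∣-∣-comm a b = trans (sym (ℚ.∣-p∣≡∣p∣ (a - b))) (cong ∣_∣ (neg-sub a b))

∣-∣≤⇒≤+ : ∀ {a b e} → ∣ a - b ∣ ≤ e → a ≤ b + e
∣-∣≤⇒≤+ {a} {b} {e} h = begin
  a            ≡⟨ +-swap a b ⟨
  b + (a - b)  ≤⟨ ℚ.+-monoʳ-≤ b (≤-trans (p≤∣p∣ (a - b)) h) ⟩
  b + e        ∎
  where open ≤-Reasoning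

≤+⇒-≤ : ∀ {a b e} → a ≤ b + e → a - b ≤ e
≤+⇒-≤ {a} {b} {e} h = begin
  a - b        ≤⟨ ℚ.+-monoˡ-≤ (- b) h ⟩
  (b + e) - b  ≡⟨ +-swap′ b e ⟩
  e            ∎
  where open ≤-Reasoning

≤+⇒∣-∣≤ : ∀ {a b e} → a ≤ b + e → b ≤ a + e → ∣ a - b ∣ ≤ e
≤+⇒∣-∣≤ {a} {b} {e} h k with ℚ.∣p∣≡p∨∣p∣≡-p (a - b)
... | inj₁ eq = ≤-trans (≤-reflexive eq) (≤+⇒-≤ h)
... | inj₂ eq = ≤-trans (≤-reflexive (trans eq (neg-sub a b))) (≤+⇒-≤ k)

½+½ : ∀ e → ½ * e + ½ * e ≡ e
½+½ e = trans (sym (ℚ.*-distribʳ-+ e ½ ½)) (ℚ.*-identityˡ e)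

0<½* : ∀ {e} → 0ℚ < e → 0ℚ < ½ * e
0<½* {e} 0<e = ℚ.positive⁻¹ (½ * e) {{ℚ.pos*pos⇒pos ½ e {{ℚ.positive 0<e}}}}

∣-∣-triangle : ∀ a b c → ∣ a - c ∣ ≤ ∣ a - b ∣ + ∣ b - c ∣
∣-∣-triangle a b c = ≤-trans
  (≤-reflexive (cong ∣_∣ (lem a b c))) (ℚ.∣p+q∣≤∣p∣+∣q∣ (a - b) (b - c))
  where
  open +-*-Solver
  lem : ∀ a b c → a - c ≡ (a - b) + (b - c)
  lem = solve 3 (λ a b c → a :+ :- c := (a :+ :- b) :+ (b :+ :- c)) refl

∣+-∣≤ : ∀ a b c d → ∣ (a + b) - (c + d) ∣ ≤ ∣ a - c ∣ + ∣ b - d ∣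
∣+-∣≤ a b c d = ≤-trans
  (≤-reflexive (cong ∣_∣ (lem a b c d))) (ℚ.∣p+q∣≤∣p∣+∣q∣ (a - c) (b - d))
  where
  open +-*-Solver
  lem : ∀ a b c d → (a + b) - (c + d) ≡ (a - c) + (b - d)
  lem = solve 4 (λ a b c d → (a :+ b) :+ :- (c :+ d) := (a :+ :- c) :+ (b :+ :- d)) refl

∣*-∣≤ : ∀ a b c d → ∣ a * b - c * d ∣ ≤ ∣ a ∣ * ∣ b - d ∣ + ∣ d ∣ * ∣ a - c ∣
∣*-∣≤ a b c d = begin
  ∣ a * b - c * d ∣                      ≡⟨ cong ∣_∣ (lem a b c d) ⟩
  ∣ a * (b - d) + d * (a - c) ∣          ≤⟨ ℚ.∣p+q∣≤∣p∣+∣q∣ (a * (b - d)) (d * (a - c)) ⟩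
  ∣ a * (b - d) ∣ + ∣ d * (a - c) ∣      ≡⟨ cong₂ _+_ (ℚ.∣p*q∣≡∣p∣*∣q∣ a (b - d)) (ℚ.∣p*q∣≡∣p∣*∣q∣ d (a - c)) ⟩
  ∣ a ∣ * ∣ b - d ∣ + ∣ d ∣ * ∣ a - c ∣  ∎
  where
  open ≤-Reasoning
  lem : ∀ a b c d → a * b - c * d ≡ a * (b - d) + d * (a - c)
  lem = solve 4 (λ a b c d → a :* b :+ :- (c :* d) := a :* (b :+ :- d) :+ d :* (a :+ :- c)) refl
    where open +-*-Solver

*-mono-≤-nonNeg : ∀ {a b c d} → 0ℚ ≤ b → 0ℚ ≤ c → a ≤ c → b ≤ d → a * b ≤ c * d
*-mono-≤-nonNeg {a} {b} {c} {d} 0≤b 0≤c a≤c b≤d = ≤-trans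
  (ℚ.*-monoʳ-≤-nonNeg b {{ℚ.nonNegative 0≤b}} a≤c)
  (ℚ.*-monoˡ-≤-nonNeg c {{ℚ.nonNegative 0≤c}} b≤d)

cauchy⇒bounded : ∀ {s} → IsCauchy s → ∃[ B ] (0ℚ < B × Eventually (λ n → ∣ s n ∣ ≤ B))
cauchy⇒bounded {s} cs with cs 1ℚ (ℚ.positive⁻¹ 1ℚ)
... | N , h = ∣ s N ∣ + 1ℚ , 0<B , N , bound
  where
  0<B : 0ℚ < ∣ s N ∣ + 1ℚ
  0<B = ℚ.+-mono-≤-< (ℚ.0≤∣p∣ (s N)) (ℚ.positive⁻¹ 1ℚ)
  open ≤-Reasoning
  bound : ∀ n → N ℕ.≤ n → ∣ s n ∣ ≤ ∣ s N ∣ + 1ℚ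
  bound n N≤n = begin
    ∣ s n ∣                  ≡⟨ cong ∣_∣ (+-swap (s n) (s N)) ⟨
    ∣ s N + (s n - s N) ∣    ≤⟨ ℚ.∣p+q∣≤∣p∣+∣q∣ (s N) (s n - s N) ⟩
    ∣ s N ∣ + ∣ s n - s N ∣  ≤⟨ ℚ.+-monoʳ-≤ ∣ s N ∣ (h n N N≤n ℕ.≤-refl) ⟩
    ∣ s N ∣ + 1ℚ             ∎

shrink : ∀ B e → 0ℚ < B → 0ℚ < e → ∃[ δ ] (0ℚ < δ × B * δ ≡ e)
shrink B e 0<B 0<e = 1/B * e , ℚ.positive⁻¹ (1/B * e) {{pos}} , eq
  where
  instance
    posB = ℚ.positive 0<B
    nzB  = ℚ.pos⇒nonZero B
  1/B = ℚ.1/ B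
  pos = ℚ.pos*pos⇒pos 1/B {{ℚ.1/pos⇒pos B}} e {{ℚ.positive 0<e}}
  eq : B * (1/B * e) ≡ e
  eq = trans (sym (ℚ.*-assoc B 1/B e)) (trans (cong (_* e) (ℚ.*-inverseʳ B)) (ℚ.*-identityˡ e))

+-cauchy : ∀ {s t} → IsCauchy s → IsCauchy t → IsCauchy (λ n → s n + t n)
+-cauchy {s} {t} cs ct ε 0<ε = M ⊔ N , λ m n m≥ n≥ → begin
  ∣ (s m + t m) - (s n + t n) ∣  ≤⟨ ∣+-∣≤ (s m) (t m) (s n) (t n) ⟩
  ∣ s m - s n ∣ + ∣ t m - t n ∣  ≤⟨ ℚ.+-mono-≤ (f m n (≥M m≥) (≥M n≥)) (g m n (≥N m≥) (≥N n≥)) ⟩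
  ½ * ε + ½ * ε                  ≡⟨ ½+½ ε ⟩
  ε                              ∎
  where
  open ≤-Reasoning
  M = proj₁ (cs (½ * ε) (0<½* 0<ε))
  f = proj₂ (cs (½ * ε) (0<½* 0<ε))
  N = proj₁ (ct (½ * ε) (0<½* 0<ε))
  g = proj₂ (ct (½ * ε) (0<½* 0<ε))
  ≥M : ∀ {n} → M ⊔ N ℕ.≤ n → M ℕ.≤ n
  ≥M = ℕ.m⊔n≤o⇒m≤o M N
  ≥N : ∀ {n} → M ⊔ N ℕ.≤ n → N ℕ.≤ n
  ≥N = ℕ.m⊔n≤o⇒n≤o M N

bounded-*-cauchy : ∀ {s t A B} → 0ℚ < A → 0ℚ < B →
  Eventually (λ n → ∣ s n ∣ ≤ A) → Eventually (λ n → ∣ t n ∣ ≤ B) →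
  IsCauchy s → IsCauchy t → IsCauchy (λ n → s n * t n)
bounded-*-cauchy {s} {t} {A} {B} 0<A 0<B (K , a) (L , b) cs ct ε 0<ε =
  goal (shrink A (½ * ε) 0<A (0<½* 0<ε)) (shrink B (½ * ε) 0<B (0<½* 0<ε))
  where
  open ≤-Reasoning
  Close : (ℕ → ℚ) → ℚ → ℕ → Set
  Close u δ N = ∀ m n → N ℕ.≤ m → N ℕ.≤ n → ∣ u m - u n ∣ ≤ δ

  close : ∀ {δ η M N} → A * δ ≡ ½ * ε → B * η ≡ ½ * ε →
          Close t δ M → Close s η N → Close (λ n → s n * t n) ε ((K ⊔ L) ⊔ (M ⊔ N))
  close {δ} {η} {M} {N} Aδ Bη g f m n m≥ n≥ = begin
    ∣ s m * t m - s n * t n ∣                          ≤⟨ ∣*-∣≤ (s m) (t m) (s n) (t n) ⟩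
    ∣ s m ∣ * ∣ t m - t n ∣ + ∣ t n ∣ * ∣ s m - s n ∣
      ≤⟨ ℚ.+-mono-≤
           (*-mono-≤-nonNeg (ℚ.0≤∣p∣ (t m - t n)) (ℚ.<⇒≤ 0<A) (a m (≥K m≥)) (g m n (≥M m≥) (≥M n≥)))
           (*-mono-≤-nonNeg (ℚ.0≤∣p∣ (s m - s n)) (ℚ.<⇒≤ 0<B) (b n (≥L n≥)) (f m n (≥N m≥) (≥N n≥))) ⟩
    A * δ + B * η                                      ≡⟨ cong₂ _+_ Aδ Bη ⟩
    ½ * ε + ½ * ε                                      ≡⟨ ½+½ ε ⟩
    ε                                                  ∎
    where
    ≥KL : ∀ {n} → (K ⊔ L) ⊔ (M ⊔ N) ℕ.≤ n → K ⊔ L ℕ.≤ n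
    ≥KL = ℕ.m⊔n≤o⇒m≤o (K ⊔ L) (M ⊔ N)
    ≥MN : ∀ {n} → (K ⊔ L) ⊔ (M ⊔ N) ℕ.≤ n → M ⊔ N ℕ.≤ n
    ≥MN = ℕ.m⊔n≤o⇒n≤o (K ⊔ L) (M ⊔ N)
    ≥K : ∀ {n} → (K ⊔ L) ⊔ (M ⊔ N) ℕ.≤ n → K ℕ.≤ n
    ≥K h = ℕ.m⊔n≤o⇒m≤o K L (≥KL h)
    ≥L : ∀ {n} → (K ⊔ L) ⊔ (M ⊔ N) ℕ.≤ n → L ℕ.≤ n
    ≥L h = ℕ.m⊔n≤o⇒n≤o K L (≥KL h)
    ≥M : ∀ {n} → (K ⊔ L) ⊔ (M ⊔ N) ℕ.≤ n → M ℕ.≤ n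
    ≥M h = ℕ.m⊔n≤o⇒m≤o M N (≥MN h)
    ≥N : ∀ {n} → (K ⊔ L) ⊔ (M ⊔ N) ℕ.≤ n → N ℕ.≤ n
    ≥N h = ℕ.m⊔n≤o⇒n≤o M N (≥MN h)

  goal : ∃[ δ ] (0ℚ < δ × A * δ ≡ ½ * ε) → ∃[ η ] (0ℚ < η × B * η ≡ ½ * ε) →
         ∃[ N ] Close (λ n → s n * t n) ε N
  goal (δ , 0<δ , Aδ) (η , 0<η , Bη) =
    _ , close Aδ Bη (proj₂ (ct δ 0<δ)) (proj₂ (cs η 0<η))

*-cauchy : ∀ {s t} → IsCauchy s → IsCauchy t → IsCauchy (λ n → s n * t n)
*-cauchy {s} {t} cs ct =
  let (A , 0<A , a) = cauchy⇒bounded {s} cs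
      (B , 0<B , b) = cauchy⇒bounded {t} ct
  in bounded-*-cauchy {s} {t} 0<A 0<B a b cs ct

record ℝ : Set where
  field
    seq    : ℕ → ℚ
    cauchy : IsCauchy seq

open ℝ public

infix  4 _≈ℝ_ _≤ℝ_ _<ℝ_
infixl 6 _+ℝ_
infixl 7 _*ℝ_
infix  8 _^⅔

_≈ℝ_ : ℝ → ℝ → Set
x ≈ℝ y = ∀ ε → 0ℚ < ε → Eventually (λ n → ∣ seq x n - seq y n ∣ ≤ ε)

_≤ℝ_ : ℝ → ℝ → Set
x ≤ℝ y = ∀ ε → 0ℚ < ε → Eventually (λ n → seq x n ≤ seq y n + ε)

_<ℝ_ : ℝ → ℝ → Set
x <ℝ y = ∃[ ε ] (0ℚ < ε × Eventually (λ n → seq x n + ε ≤ seq y n))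

fromℚ : ℚ → ℝ
fromℚ q .seq _ = q
fromℚ q .cauchy ε 0<ε = 0 , λ _ _ _ _ →
  ≤-trans (≤-reflexive (cong ∣_∣ (ℚ.+-inverseʳ q))) (ℚ.<⇒≤ 0<ε)

fromℕ : ℕ → ℝ
fromℕ n = fromℚ (ℤ.+ n / 1)

0ℝ : ℝ
0ℝ = fromℚ 0ℚ

_+ℝ_ : ℝ → ℝ → ℝ
(x +ℝ y) .seq n = seq x n + seq y n
(x +ℝ y) .cauchy = +-cauchy {seq x} {seq y} (cauchy x) (cauchy y)

_*ℝ_ : ℝ → ℝ → ℝ
(x *ℝ y) .seq n = seq x n * seq y n
(x *ℝ y) .cauchy = *-cauchy {seq x} {seq y} (cauchy x) (cauchy y)

≈ℝ-refl : ∀ {x} → x ≈ℝ x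
≈ℝ-refl {x} ε 0<ε = always λ n →
  ≤-trans (≤-reflexive (cong ∣_∣ (ℚ.+-inverseʳ (seq x n)))) (ℚ.<⇒≤ 0<ε)

≈ℝ-sym : ∀ {x y} → x ≈ℝ y → y ≈ℝ x
≈ℝ-sym {x} {y} h ε 0<ε = eventually-map
  (λ {n} → ≤-trans (≤-reflexive (∣-∣-comm (seq y n) (seq x n)))) (h ε 0<ε)

≈ℝ-trans : ∀ {x y z} → x ≈ℝ y → y ≈ℝ z → x ≈ℝ z
≈ℝ-trans {x} {y} {z} h k ε 0<ε = eventually-zip
  (λ {n} p q → begin
    ∣ seq x n - seq z n ∣                          ≤⟨ ∣-∣-triangle (seq x n) (seq y n) (seq z n) ⟩
    ∣ seq x n - seq y n ∣ + ∣ seq y n - seq z n ∣  ≤⟨ ℚ.+-mono-≤ p q ⟩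
    ½ * ε + ½ * ε                                  ≡⟨ ½+½ ε ⟩
    ε                                              ∎)
  (h (½ * ε) (0<½* 0<ε)) (k (½ * ε) (0<½* 0<ε))
  where open ≤-Reasoning

≈ℝ-isEquivalence : IsEquivalence _≈ℝ_
≈ℝ-isEquivalence = record
  { refl  = λ {x} → ≈ℝ-refl {x}
  ; sym   = λ {x} {y} → ≈ℝ-sym {x} {y}
  ; trans = λ {x} {y} {z} → ≈ℝ-trans {x} {y} {z}
  }

≤ℝ-reflexive : ∀ {x y} → x ≈ℝ y → x ≤ℝ y
≤ℝ-reflexive h ε 0<ε = eventually-map ∣-∣≤⇒≤+ (h ε 0<ε)

≤ℝ-antisym : ∀ {x y} → x ≤ℝ y → y ≤ℝ x → x ≈ℝ y
≤ℝ-antisym h k ε 0<ε = eventually-zip ≤+⇒∣-∣≤ (h ε 0<ε) (k ε 0<ε)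

≤ℝ-trans : ∀ {x y z} → x ≤ℝ y → y ≤ℝ z → x ≤ℝ z
≤ℝ-trans {x} {y} {z} h k ε 0<ε = eventually-zip
  (λ {n} p q → begin
    seq x n                    ≤⟨ p ⟩
    seq y n + ½ * ε            ≤⟨ ℚ.+-monoˡ-≤ (½ * ε) q ⟩
    seq z n + ½ * ε + ½ * ε    ≡⟨ ℚ.+-assoc (seq z n) (½ * ε) (½ * ε) ⟩
    seq z n + (½ * ε + ½ * ε)  ≡⟨ cong (seq z n +_) (½+½ ε) ⟩
    seq z n + ε                ∎)
  (h (½ * ε) (0<½* 0<ε)) (k (½ * ε) (0<½* 0<ε))
  where open ≤-Reasoning

≤ℝ-isPartialOrder : IsPartialOrder _≈ℝ_ _≤ℝ_
≤ℝ-isPartialOrder = record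
  { isPreorder = record
    { isEquivalence = ≈ℝ-isEquivalence
    ; reflexive     = λ {x} {y} → ≤ℝ-reflexive {x} {y}
    ; trans         = λ {x} {y} {z} → ≤ℝ-trans {x} {y} {z}
    }
  ; antisym = λ {x} {y} → ≤ℝ-antisym {x} {y}
  }

cbrt : ∀ m → ∃[ r ] (r ℕ.^ 3 ℕ.≤ m × m ℕ.< suc r ℕ.^ 3)
cbrt zero = 0 , ℕ.z≤n , ℕ.s≤s ℕ.z≤n
cbrt (suc m) with cbrt m
... | r , lo , hi with suc r ℕ.^ 3 ℕ.≤? suc m
...   | yes p = suc r , p , ℕ.≤-<-trans hi (ℕ.^-monoˡ-< 3 (ℕ.n<1+n (suc r)))
...   | no ¬p = r , ℕ.m≤n⇒m≤1+n lo , ℕ.≰⇒> ¬p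

⌊∛_⌋ : ℕ → ℕ
⌊∛ m ⌋ = proj₁ (cbrt m)

cube-cancel-< : ∀ a b → a ℕ.^ 3 ℕ.< b ℕ.^ 3 → a ℕ.< b
cube-cancel-< a b h with a ℕ.<? b
... | yes p = p
... | no ¬p = ⊥-elim (ℕ.<⇒≱ h (ℕ.^-monoˡ-≤ 3 (ℕ.≮⇒≥ ¬p)))

cube-* : ∀ a b → (a ℕ.* b) ℕ.^ 3 ≡ a ℕ.^ 3 ℕ.* b ℕ.^ 3
cube-* = lem
  where
  lem : ∀ a b → (a ℕ.* b) ℕ.* ((a ℕ.* b) ℕ.* ((a ℕ.* b) ℕ.* 1)) ≡
                (a ℕ.* (a ℕ.* (a ℕ.* 1))) ℕ.* (b ℕ.* (b ℕ.* (b ℕ.* 1)))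
  lem = ℕSolver.solve-∀

⌊∛⌋-cross : ∀ q J K → .{{ℕ.NonZero J}} → let a = ⌊∛ q ℕ.* J ℕ.^ 3 ⌋ ; b = ⌊∛ q ℕ.* K ℕ.^ 3 ⌋ in
            a ℕ.* K ℕ.≤ suc b ℕ.* J
⌊∛⌋-cross q J K = ℕ.<⇒≤ (cube-cancel-< (a ℕ.* K) (suc b ℕ.* J) (begin-strict
  (a ℕ.* K) ℕ.^ 3               ≡⟨ cube-* a K ⟩
  a ℕ.^ 3 ℕ.* K ℕ.^ 3           ≤⟨ ℕ.*-monoˡ-≤ (K ℕ.^ 3) (proj₁ (proj₂ (cbrt (q ℕ.* J ℕ.^ 3)))) ⟩
  q ℕ.* J ℕ.^ 3 ℕ.* K ℕ.^ 3     ≡⟨ comm q (J ℕ.^ 3) (K ℕ.^ 3) ⟩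
  q ℕ.* K ℕ.^ 3 ℕ.* J ℕ.^ 3     <⟨ ℕ.*-monoˡ-< (J ℕ.^ 3) {{ℕ.m^n≢0 J 3}} (proj₂ (proj₂ (cbrt (q ℕ.* K ℕ.^ 3)))) ⟩
  suc b ℕ.^ 3 ℕ.* J ℕ.^ 3       ≡⟨ cube-* (suc b) J ⟨
  (suc b ℕ.* J) ℕ.^ 3           ∎))
  where
  open ℕ.≤-Reasoning
  a = ⌊∛ q ℕ.* J ℕ.^ 3 ⌋
  b = ⌊∛ q ℕ.* K ℕ.^ 3 ⌋
  comm : ∀ x y z → x ℕ.* y ℕ.* z ≡ x ℕ.* z ℕ.* y
  comm = ℕSolver.solve-∀

/-mono-≤ : ∀ a b j k → a ℕ.* suc k ℕ.≤ b ℕ.* suc j → ℤ.+ a / suc j ≤ ℤ.+ b / suc k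
/-mono-≤ a b j k h = ℚ.toℚᵘ-cancel-≤ (begin
  ℚ.toℚᵘ (ℤ.+ a / suc j)  ≃⟨ ℚ.toℚᵘ-fromℚᵘ (mkℚᵘ (ℤ.+ a) j) ⟩
  mkℚᵘ (ℤ.+ a) j          ≤⟨ ℚᵘ.*≤* (subst₂′ (ℤ.pos-* a (suc k)) (ℤ.pos-* b (suc j)) (ℤ.+≤+ h)) ⟩
  mkℚᵘ (ℤ.+ b) k          ≃⟨ ℚ.toℚᵘ-fromℚᵘ (mkℚᵘ (ℤ.+ b) k) ⟨
  ℚ.toℚᵘ (ℤ.+ b / suc k)  ∎)
  where
  open ℚᵘ.≤-Reasoning
  subst₂′ : ∀ {x y u v} → x ≡ u → y ≡ v → x ℤ.≤ y → u ℤ.≤ v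
  subst₂′ refl refl p = p

/-suc : ∀ b k → ℤ.+ suc b / suc k ≡ ℤ.+ b / suc k + ℤ.+ 1 / suc k
/-suc b k = ℚ.toℚᵘ-injective (begin
  ℚ.toℚᵘ (ℤ.+ suc b / suc k)                          ≈⟨ ℚ.toℚᵘ-fromℚᵘ (mkℚᵘ (ℤ.+ suc b) k) ⟩
  mkℚᵘ (ℤ.+ suc b) k                                  ≈⟨ ℚᵘ.*≡* eq ⟩
  mkℚᵘ (ℤ.+ b) k ℚᵘ.+ mkℚᵘ (ℤ.+ 1) k
    ≈⟨ ℚᵘ.+-cong (ℚ.toℚᵘ-fromℚᵘ (mkℚᵘ (ℤ.+ b) k)) (ℚ.toℚᵘ-fromℚᵘ (mkℚᵘ (ℤ.+ 1) k)) ⟨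
  ℚ.toℚᵘ (ℤ.+ b / suc k) ℚᵘ.+ ℚ.toℚᵘ (ℤ.+ 1 / suc k)  ≈⟨ ℚ.toℚᵘ-homo-+ (ℤ.+ b / suc k) (ℤ.+ 1 / suc k) ⟨
  ℚ.toℚᵘ (ℤ.+ b / suc k + ℤ.+ 1 / suc k)              ∎)
  where
  open import Relation.Binary.Reasoning.Setoid ℚᵘ.≃-setoid
  K = ℤ.+ suc k
  eq : ℤ.+ suc b ℤ.* ℤ.+ (suc k ℕ.* suc k) ≡ (ℤ.+ b ℤ.* K ℤ.+ ℤ.+ 1 ℤ.* K) ℤ.* K
  eq = trans (cong (ℤ.+ suc b ℤ.*_) (ℤ.pos-* (suc k) (suc k)))
      (trans (sym (ℤ.*-assoc (ℤ.+ suc b) K K))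
             (cong (ℤ._* K) (trans (cong (λ t → ℤ.+ t ℤ.* K) (sym (ℕ.+-comm b 1)))
                                   (trans (cong (ℤ._* K) (ℤ.pos-+ b 1)) (ℤ.*-distribʳ-+ K (ℤ.+ b) (ℤ.+ 1))))))

archimedean : ∀ ε → 0ℚ < ε → ∃[ d ] ℤ.+ 1 / suc d ≤ ε
archimedean ε@(mkℚ (ℤ.+ suc p) d _) _ = d , ≤-trans
  (/-mono-≤ 1 (suc p) d d (ℕ.*-monoˡ-≤ (suc d) {1} {suc p} (ℕ.s≤s ℕ.z≤n)))
  (≤-reflexive (ℚ.↥p/↧p≡p ε))
archimedean (mkℚ (ℤ.+ zero) d _) (ℚ.*<* (ℤ.+<+ ()))
archimedean (mkℚ (ℤ.-[1+ p ]) d _) (ℚ.*<* ())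

-- The k-th approximation is ⌊(k+1)·n^{2/3}⌋ / (k+1).
_^⅔ : ℕ → ℝ
(n ^⅔) .seq k = ℤ.+ ⌊∛ (n ℕ.^ 2) ℕ.* (suc k) ℕ.^ 3 ⌋ / suc k
(n ^⅔) .cauchy ε 0<ε with archimedean ε 0<ε
... | d , d≤ε = d , λ j k d≤j d≤k → ≤+⇒∣-∣≤ (bound j k d≤k) (bound k j d≤j)
  where
  s = λ k → ⌊∛ (n ℕ.^ 2) ℕ.* (suc k) ℕ.^ 3 ⌋
  open ≤-Reasoning
  bound : ∀ j k → d ℕ.≤ k → ℤ.+ s j / suc j ≤ ℤ.+ s k / suc k + ε
  bound j k d≤k = begin
    ℤ.+ s j / suc j                    ≤⟨ /-mono-≤ (s j) (suc (s k)) j k (⌊∛⌋-cross (n ℕ.^ 2) (suc j) (suc k)) ⟩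
    ℤ.+ suc (s k) / suc k              ≡⟨ /-suc (s k) k ⟩
    ℤ.+ s k / suc k + ℤ.+ 1 / suc k    ≤⟨ ℚ.+-monoʳ-≤ (ℤ.+ s k / suc k) (/-mono-≤ 1 1 k d (ℕ.*-monoʳ-≤ 1 (ℕ.s≤s d≤k))) ⟩
    ℤ.+ s k / suc k + ℤ.+ 1 / suc d    ≤⟨ ℚ.+-monoʳ-≤ (ℤ.+ s k / suc k) d≤ε ⟩
    ℤ.+ s k / suc k + ε                ∎

module _ {V : Set} (ρ : V → V → ℝ) where

  IsMetric : Set
  IsMetric = IsGeneralMetric _≡_ _≈ℝ_ _≤ℝ_ 0ℝ _+ℝ_ ρ

  line : V → V → Pred V 0ℓ
  line a b x = (ρ x b ≈ℝ ρ x a +ℝ ρ a b)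
             ⊎ (ρ a b ≈ℝ ρ a x +ℝ ρ x b)
             ⊎ (ρ a x ≈ℝ ρ a b +ℝ ρ b x)

  IsLine : Pred V 0ℓ → Set
  IsLine L = ∃₂ λ a b → a ≢ b × L ≐ line a b

  HasUniversalLine : Set
  HasUniversalLine = IsLine U

  -- Exhibiting such a family means deciding equalities between real numbers,
  -- so from ρ alone it can be expected only up to ¬ ¬ (classically redundant).
  HasDistinctLines : ℕ → Set₁
  HasDistinctLines m = ∃ λ (L : Fin m → Pred V 0ℓ) →
    (∀ i → IsLine (L i)) × (∀ i j → i ≢ j → ¬ (L i ≐ L j))

module Submission where

-- Suppose there are m lines.  Every line L is generated by O(m²) ordered pairs, apart from
-- O(n m √m) exceptional pairs in total; summing over the lines gives n² = O(n m √m + m³),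
-- so m is at least of order n^(2/3).
--
-- Exceptional pairs.  The points x for which ax generates L are ordered by betweenness from a.
-- The points of one level of this order see each other through a, so they span pairwise
-- distinct lines; hence the top two levels together contain O(√m) points.
--
-- Remaining pairs.  If o is an end of a diametral pair of the points involved in generating L,
-- then no remaining pair bu has o strictly inside, so bu may be taken to point away from o.
-- The number of far ends u is at most 2m: let i be a minimal extension of bu (a cover), U the
-- next end after u and y a point off the line uU.  Two lines yu with different u can only agree
-- if b and i agree as well, and vertices u sharing b and i see each other through b, so the
-- lines joining them to one representative are again distinct.  With u in the role of o the
-- same bound applies to the possible b.
--
-- Order comparisons of distances are undecidable, so all of this happens under a double negation.

open import Defs
open import Data.Empty using (⊥; ⊥-elim)
open import Data.Fin.Base using (Fin; zero; suc; inject≤)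
open import Data.Fin.Properties using (_≟_; all?; any?; ¬∀⟶∃¬; inject≤-injective; sequence)
import Data.Integer.Base as ℤ
import Data.Integer.Properties as ℤ
open import Data.List.Base using (List; []; _∷_; length; filter; allFin; cartesianProduct; map)
open import Data.List.Membership.Propositional using (_∈_)
open import Data.List.Membership.Propositional.Properties
  using (∈-filter⁻; ∈-filter⁺; ∈-allFin; ∈-cartesianProduct⁻; ∈-cartesianProduct⁺)
open import Data.List.Properties using (length-++; length-map; length-tabulate)
open import Data.List.Relation.Unary.All using (_∷_)
open import Data.List.Relation.Unary.AllPairs using ([]; _∷_)
open import Data.List.Relation.Unary.Any using (here; there)
open import Data.List.Relation.Unary.Unique.Propositional using (Unique)
open import Data.List.Relation.Unary.Unique.Propositional.Properties using (filter⁺; allFin⁺; cartesianProduct⁺)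
open import Data.Nat.Base as ℕ using (ℕ; zero; suc; _+_; _*_; _^_; _≤_; _<_; z≤n; s≤s)
import Data.Nat.Properties as ℕ
open import Data.Nat.Tactic.RingSolver using (solve-∀)
open import Data.Product.Base using (∃; ∃-syntax; ∃₂; _×_; _,_; proj₁; proj₂; swap)
open import Data.Product.Properties using (≡-dec)
open import Data.Rational.Base as ℚ using (ℚ; 0ℚ; ½; ∣_∣)
import Data.Rational.Properties as ℚ
open import Data.Rational.Solver using (module +-*-Solver)
import Data.Rational.Unnormalised.Base as ℚᵘ
import Data.Rational.Unnormalised.Properties as ℚᵘ
open import Data.Sum.Base using (_⊎_; inj₁; inj₂)
open import Data.Unit.Base using (tt)
open import Effect.Monad using (RawMonad)
open import Function.Base using (_∘_; id)
open import Function.Bundles using (_↔_; Inverse)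
open import Function.Metric.Structures using (IsGeneralMetric)
open import Level using (0ℓ)
open import Relation.Binary.Definitions using (DecidableEquality)
open import Relation.Binary.PropositionalEquality
  using (_≡_; _≢_; refl; sym; trans; cong; cong₂; subst; subst₂; ≢-sym)
open import Relation.Nullary using (¬_; Dec; yes; no; ¬?; _×-dec_; _⊎-dec_; _→-dec_; ¬¬-map)
open import Relation.Nullary.Decidable.Core using (¬¬-excluded-middle; toSum)
open import Relation.Nullary.Negation using (¬¬-Monad)
open import Relation.Unary as Unary using (Pred; Decidable; _≐_)
open import Relation.Unary.Properties using (≐-refl)

-- Abstract betweenness and its lines.

-- B is weak: b may coincide with a or c.
record Betweenness (V : Set) : Set₁ where
  field
    B         : V → V → V → Set
    B-sym     : ∀ {a b c} → B a b c → B c b a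
    B-refl    : ∀ {a b} → B a a b
    B-outer   : ∀ {a b c d} → B a b c → B a c d → B a b d
    B-inner   : ∀ {a b c d} → B a b c → B a c d → B b c d
    B-antisym : ∀ {a b c} → B a b c → B a c b → b ≡ c

  B-outer′ : ∀ {a b c d} → B a b d → B b c d → B a c d
  B-outer′ p q = B-sym (B-outer (B-sym q) (B-sym p))

  B-inner′ : ∀ {a b c d} → B a b d → B b c d → B a b c
  B-inner′ p q = B-sym (B-inner (B-sym q) (B-sym p))

  B-antisym′ : ∀ {a b c} → B a b c → B b a c → a ≡ b
  B-antisym′ p q = B-antisym (B-sym q) (B-sym p)

  infix 4 _∈ℓ_

  _∈ℓ_ : V → V × V → Set
  p ∈ℓ (a , b) = B p a b ⊎ B a p b ⊎ B a b p

  pattern before p = inj₁ p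
  pattern between p = inj₂ (inj₁ p)
  pattern after p = inj₂ (inj₂ p)

  ∈ℓ-flip : ∀ {p a b} → p ∈ℓ (a , b) → p ∈ℓ (b , a)
  ∈ℓ-flip (before p)  = after (B-sym p)
  ∈ℓ-flip (between p) = between (B-sym p)
  ∈ℓ-flip (after p)   = before (B-sym p)

  ∈ℓ-rotate : ∀ {p a b} → p ∈ℓ (a , b) → a ∈ℓ (b , p)
  ∈ℓ-rotate (before p)  = between (B-sym p)
  ∈ℓ-rotate (between p) = after (B-sym p)
  ∈ℓ-rotate (after p)   = before p

  ∈ℓ-left : ∀ {a b} → a ∈ℓ (a , b)
  ∈ℓ-left = before B-refl

  ∈ℓ-right : ∀ {a b} → b ∈ℓ (a , b)
  ∈ℓ-right = after (B-sym B-refl)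

  Nonuniversal : Set
  Nonuniversal = ∀ {a b} → a ≢ b → ∃ λ z → ¬ z ∈ℓ (a , b)

  -- A labelling by lines; exchanging the two pairs gives the other inclusion.
  Respects : ∀ {m} → (V → V → Fin m) → Set
  Respects ℓ = ∀ {a b c d p} → a ≢ b → c ≢ d → ℓ a b ≡ ℓ c d → p ∈ℓ (a , b) → p ∈ℓ (c , d)

  -- `o` and `p` stand for a diametral pair of `P`, expressed without distances. The extension `w`
  -- makes `bu` strictly shorter than the diameter, which excludes a 4-cycle with diagonals `op` and
  -- `bu`.
  Extremal : Set₁
  Extremal = {P : V → Set} → Decidable P → ∃ P → ∃₂ λ o p → P o × P p ×
    (∀ {b u w} → P b → P u → P w → B b u w → u ≢ w → p ∈ℓ (b , u) → B b o u → o ≡ b ⊎ o ≡ u)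

  -- The middle one of three collinear points would be squeezed onto `s`: `psq` and `pqr` give
  -- `sqr`, which with `qsr` forces `q ≡ s`.
  star-noncollinear : ∀ {s p q r} → B p s q → B q s r → B p s r → p ∈ℓ (q , r) →
                      p ≡ s ⊎ q ≡ s ⊎ r ≡ s
  star-noncollinear psq qsr psr (before pqr) = inj₂ (inj₁ (B-antisym′ qsr (B-inner psq pqr)))
  star-noncollinear psq qsr psr (between qpr) = inj₁ (B-antisym′ psr (B-inner (B-sym psq) qpr))
  star-noncollinear psq qsr psr (after qrp) = inj₂ (inj₂ (B-antisym′ (B-sym psr) (B-inner qsr qrp)))

-- Arcs pointing away from a root, and when their assigned lines agree.

-- E consists of pairs generating one common line L.
module Rooted {V : Set} (β : Betweenness V)
  (E : V → V → Set) (E-distinct : ∀ {a b} → E a b → a ≢ b)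
  (E-same : ∀ {a b c d p} → E a b → E c d →
            Betweenness._∈ℓ_ β p (a , b) → Betweenness._∈ℓ_ β p (c , d))
  (o : V) where

  open Betweenness β

  OnLine : V → Set
  OnLine p = ∀ {a b} → E a b → p ∈ℓ (a , b)

  onLine : ∀ {p a b} → E a b → p ∈ℓ (a , b) → OnLine p
  onLine e p∈ f = E-same e f p∈

  Arc : V → V → Set
  Arc b u = E b u × B o b u

  Cover : V → V → V → Set
  Cover b u i = Arc b i × B b u i × u ≢ i ×
                (∀ w → Arc b w → B b u w → B b w i → w ≡ u ⊎ w ≡ i)

  -- The second alternative is the exotic one: together with `B b u i` it is the pattern of `y`,
  -- `b`, `u`, `i` as consecutive vertices of a 4-cycle.
  Kind : V → V → V → V → Set
  Kind b u i y = (∀ {a c} → E a c → ¬ y ∈ℓ (a , c)) ⊎ (OnLine y × B y b u × B b y i)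

  Aligned : V → V → V → Set
  Aligned c u w = B c u w ⊎ B u c w

  -- The line `yu` is the one assigned to the far end `u`. `minimal` admits arcs from any `c`
  -- aligned with `u`, since `below` applies it to the arc of a different step.
  record Step (b u i y : V) : Set where
    field
      arc     : Arc b u
      cover   : Cover b u i
      U       : V
      u≢U     : u ≢ U
      ouU     : B o u U
      oUi     : B o U i
      onU     : OnLine U
      minimal : ∀ w c → Arc c w → Aligned c u w → B o u w → B o w U → w ≡ u ⊎ w ≡ U
      y∉uU    : ¬ y ∈ℓ (u , U)
      kind    : Kind b u i y

    Ebu : E b u
    Ebu = proj₁ arc
    obu : B o b u
    obu = proj₂ arc
    Ebi : E b i
    Ebi = proj₁ (proj₁ cover)
    obi : B o b i
    obi = proj₂ (proj₁ cover)
    bui : B b u i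
    bui = proj₁ (proj₂ cover)
    b≢u : b ≢ u
    b≢u = E-distinct Ebu
    buU : B b u U
    buU = B-inner obu ouU
    bUi : B b U i
    bUi = B-inner (B-outer obu ouU) oUi
    onb : OnLine b
    onb = onLine Ebu ∈ℓ-left
    onu : OnLine u
    onu = onLine Ebu ∈ℓ-right

    y≢u : y ≢ u
    y≢u refl = y∉uU ∈ℓ-left

    y≢b : y ≢ b
    y≢b refl = y∉uU (before buU)

    ¬buy : ¬ B b u y
    ¬buy buy with kind
    ... | inj₁ y∉ = y∉ Ebu (after buy)
    ... | inj₂ (_ , ybu , _) = b≢u (B-antisym ybu (B-sym buy))

    ¬between-beyond : ∀ {v} → B b u v → ¬ B u y v
    ¬between-beyond buv uyv = ¬buy (B-inner′ buv uyv)

    kind-on : OnLine y → B y b u × B b y i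
    kind-on ony with kind
    ... | inj₁ y∉ = ⊥-elim (y∉ Ebu (ony Ebu))
    ... | inj₂ (_ , q) = q

    -- Unless `y` lies between `u` and `v`, each order of these three points puts `y` on `uU`,
    -- because `U` is between `u` and `v`.
    not-beyond : ∀ {v} → B u U v → ¬ B u y v → ¬ v ∈ℓ (y , u)
    not-beyond uUv ¬uyv (before vyu)  = ¬uyv (B-sym vyu)
    not-beyond uUv ¬uyv (between yvu) = y∉uU (after (B-outer uUv (B-sym yvu)))
    not-beyond uUv ¬uyv (after yuv)   = y∉uU (before (B-sym (B-inner (B-sym uUv) (B-sym yuv))))

    -- If `v` is between `y` and `u`, then `y` is on L, hence exotic, and `byi` squeezes `v` onto
    -- `b`. The other positions contradict `y∉uU` and `¬buy`.
    far-side : ∀ {v} → B v b i → v ∈ℓ (y , u) → v ≡ b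
    far-side vbi v∈ = go v∈
      where
      vbu = B-inner′ vbi bui
      go : _ ∈ℓ (y , u) → _
      go (before vyu)  = ⊥-elim (y∉uU (before (B-inner vyu (B-outer′ (B-inner′ vbi bUi) buU))))
      go (after yuv)   = ⊥-elim (¬buy (B-inner vbu (B-sym yuv)))
      go (between yvu) with kind
      ... | inj₁ y∉ = ⊥-elim (y∉ Ebu (before (B-sym (B-outer (B-sym vbu) (B-sym yvu)))))
      ... | inj₂ (_ , _ , byi) = B-antisym′ (B-inner′ vbi byi) (B-inner (B-sym vbu) (B-sym yvu))

    -- The last alternative is the exotic pattern of `Kind` with `v` in place of `y`.
    Position : V → Set
    Position v = B b v u ⊎ (B b u v × B b v i) ⊎ (B v b u × B b v i)

    -- The point `v` is placed on the lines `bu` and `bi`, both equal to L. Behind `b` only `b`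
    -- itself survives, by `far-side`; beyond `i` nothing does, by `not-beyond`.
    position : ∀ {v} → OnLine v → v ∈ℓ (y , u) → Position v
    position onv v∈ with onv Ebu | onv Ebi
    ... | between bvu | _ = inj₁ bvu
    ... | before vbu | before vbi = inj₁ (subst (λ x → B b x u) (sym (far-side vbi v∈)) B-refl)
    ... | before vbu | between bvi = inj₂ (inj₂ (vbu , bvi))
    ... | before vbu | after biv = ⊥-elim (b≢u (B-antisym vbu (B-sym (B-outer bui biv))))
    ... | after buv | before vbi = ⊥-elim (b≢u (B-antisym (B-inner′ vbi bui) (B-sym buv)))
    ... | after buv | between bvi = inj₂ (inj₁ (buv , bvi))
    ... | after buv | after biv =
      ⊥-elim (not-beyond (B-inner buU (B-outer bUi biv)) (¬between-beyond (B-outer bui biv)) v∈)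

  module Collision {b u i y c v j z} (s : Step b u i y) (t : Step c v j z)
    (u≢v : u ≢ v) (yu⊆zv : ∀ {p} → p ∈ℓ (y , u) → p ∈ℓ (z , v))
    (zv⊆yu : ∀ {p} → p ∈ℓ (z , v) → p ∈ℓ (y , u)) where

    private
      module s = Step s
      module t = Step t

    v∈yu : v ∈ℓ (y , u)
    v∈yu = zv⊆yu ∈ℓ-right

    u∈zv : u ∈ℓ (z , v)
    u∈zv = yu⊆zv ∈ℓ-right

    V∉yu : ¬ t.U ∈ℓ (y , u)
    V∉yu V∈ = t.y∉uU (∈ℓ-rotate (yu⊆zv V∈))

    -- If c = u then uv generates L, so y and z lie on L and both kinds are exotic.
    chained : c ≡ u → ¬ B b u v
    chained refl buv = go (ony t.Ebi)
      where
      ony : OnLine y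
      ony = onLine t.Ebu (∈ℓ-rotate v∈yu)
      onz : OnLine z
      onz = onLine t.Ebu (∈ℓ-flip (∈ℓ-rotate u∈zv))
      ybu = proj₁ (s.kind-on ony)
      zuv = proj₁ (t.kind-on onz)
      uzj = proj₂ (t.kind-on onz)
      go : ¬ y ∈ℓ (u , j)
      -- Here `u` lies between any two of `b`, `z` and `v`, yet `b` is on `yu`, which is contained
      -- in `zv`.
      go (before yuj)
        with star-noncollinear (B-inner ybu (B-inner′ yuj uzj)) zuv buv (yu⊆zv (between ybu))
      ... | inj₁ b≡u = s.b≢u b≡u
      ... | inj₂ (inj₁ z≡u) = t.y≢b z≡u
      ... | inj₂ (inj₂ v≡u) = u≢v (sym v≡u)
      go (between uyj) = s.b≢u (B-antisym s.obu (B-inner′ (B-inner′ t.obi uyj) (B-sym ybu)))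
      go (after ujy)   = V∉yu (between (B-sym (B-outer t.bUi ujy)))

    -- The next end `t.U` after `v` is placed on the line `bu`. Beyond `u`, its minimality forces
    -- `u ≡ v` or `u ≡ t.U`, both excluded; inside `bu` it contradicts `not-beyond`; behind `b` it
    -- squeezes `b` onto `v`.
    below : B b v u → B c v u → b ≢ v → ⊥
    below bvu cvu b≢v with t.onU s.Ebu
    ... | between bVu = t.not-beyond (B-inner t.ouU (B-outer′ s.obu bVu)) (t.¬between-beyond cvu) u∈zv
    ... | before Vbu = b≢v (B-antisym (B-inner′ s.obu bvu)
                         (B-inner′ t.ouU (B-inner (B-sym bvu) (B-sym Vbu))))
    ... | after buV
        with t.minimal u b s.arc (inj₁ bvu) (B-outer′ s.obu bvu) (B-outer′ t.ouU (B-inner bvu buV))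
    ...   | inj₁ u≡v = u≢v u≡v
    ...   | inj₂ u≡V = V∉yu (subst (_∈ℓ (y , u)) u≡V ∈ℓ-right)

    exotic-below : B v b u × B b v i → ¬ B c u v
    exotic-below (vbu , _) cuv =
      s.b≢u (B-antisym vbu (B-sym (B-inner s.obu (B-outer′ t.obu cuv))))

    exotic-above : B v b u × B b v i → B c v u × B c u j → b ≡ v
    exotic-above (vbu , bvi) (cvu , cuj) =
      B-antisym (B-inner′ s.obi bvi) (B-inner′ (B-outer′ (B-inner′ t.obi cuj) cvu) vbu)

    -- The point `b` is placed on the line `cj`. Before `j`, on either side of `c`, both `B o b c`
    -- and `B o c b` hold; beyond `j` it would force `u ≡ j` and then `c ≡ v`.
    exotic : B v b u × B b v i → B u c v × B c u j → b ≡ c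
    exotic (vbu , bvi) (ucv , cuj) with s.onb t.Ebi
    ... | before bcj = B-antisym (B-inner′ s.obu bcu) (B-inner′ t.obu (B-inner (B-sym bcu) (B-sym vbu)))
      where bcu = B-inner′ bcj cuj
    ... | between cbj = B-antisym (B-inner′ obv (B-inner (B-sym (B-inner ocb s.obu)) ucv)) ocb
      where
      obv = B-inner′ s.obi bvi
      ocb = B-inner′ t.obi cbj
    ... | after cjb = ⊥-elim (t.b≢u (B-antisym ucv (B-sym (subst (B c v) (sym u≡j) t.bui))))
      where u≡j = B-antisym (B-inner s.obu (B-outer′ t.obi cuj)) (B-sym (B-inner cuj cjb))

    -- The cover `i` is beyond `v` and `j` is beyond `u`, so each competes in the minimality of the
    -- other.
    same-cover : b ≡ c → B v b u × B b v i → B u c v × B c u j → i ≡ j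
    same-cover refl (vbu , bvi) (ubv , buj) with onLine s.Ebi ∈ℓ-right t.Ebi
    ... | before ibj = ⊥-elim (s.b≢u (B-antisym′ buj (B-inner (B-sym s.bui) ibj)))
    ... | between bij with proj₂ (proj₂ (proj₂ t.cover)) i (proj₁ s.cover) bvi bij
    ...   | inj₁ refl = ⊥-elim (s.b≢u (B-antisym vbu (B-sym s.bui)))
    ...   | inj₂ i≡j = i≡j
    same-cover refl (vbu , bvi) (ubv , buj) | after bji
      with proj₂ (proj₂ (proj₂ s.cover)) j (proj₁ t.cover) buj bji
    ...   | inj₁ refl = ⊥-elim (t.b≢u (B-antisym ubv (B-sym t.bui)))
    ...   | inj₂ j≡i = sym j≡i

  -- Each of `u` and `v` has one of three positions relative to the step of the other. Antisymmetry,
  -- `below`, `chained` and the squeezes in `exotic-below` and `exotic-above` refute every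
  -- combination but the doubly exotic one.
  collision : ∀ {b u i y c v j z} → Step b u i y → Step c v j z → u ≢ v →
              (∀ {p} → p ∈ℓ (y , u) → p ∈ℓ (z , v)) → (∀ {p} → p ∈ℓ (z , v) → p ∈ℓ (y , u)) →
              b ≡ c × i ≡ j
  collision {b} {u} {i} {y} {c} {v} {j} {z} s t u≢v f g = go
    where
    module s = Step s
    module t = Step t
    module C = Collision s t u≢v f g
    module D = Collision t s (≢-sym u≢v) g f
    go : b ≡ c × i ≡ j
    go with s.position t.onu C.v∈yu | t.position s.onu C.u∈zv
    ... | inj₁ bvu | inj₁ cuv = ⊥-elim (u≢v (B-antisym (B-outer′ t.obu cuv) (B-outer′ s.obu bvu)))
    ... | inj₁ bvu | inj₂ (inj₁ (cvu , _)) = ⊥-elim (C.below bvu cvu λ b≡v → D.chained b≡v cvu)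
    ... | inj₁ bvu | inj₂ (inj₂ q) = ⊥-elim (D.exotic-below q bvu)
    ... | inj₂ (inj₁ (buv , _)) | inj₁ cuv = ⊥-elim (D.below cuv buv λ c≡u → C.chained c≡u buv)
    ... | inj₂ (inj₁ (buv , bvi)) | inj₂ (inj₁ (cvu , cuj)) =
      ⊥-elim (u≢v (B-antisym (B-outer′ (B-inner′ s.obi bvi) buv) (B-outer′ (B-inner′ t.obi cuj) cvu)))
    ... | inj₂ (inj₁ p) | inj₂ (inj₂ q) = ⊥-elim (C.chained (D.exotic-above q p) (proj₁ p))
    ... | inj₂ (inj₂ p) | inj₁ cuv = ⊥-elim (C.exotic-below p cuv)
    ... | inj₂ (inj₂ p) | inj₂ (inj₁ q) = ⊥-elim (D.chained (C.exotic-above p q) (proj₁ q))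
    ... | inj₂ (inj₂ p) | inj₂ (inj₂ q) = C.exotic p q , C.same-cover (C.exotic p q) p q

  cover-unique : ∀ {b u i j} → b ≢ u → Cover b u i → Cover b u j → i ≡ j
  cover-unique b≢u (bi , bui , u≢i , mini) (bj , buj , u≢j , minj)
    with onLine (proj₁ bi) ∈ℓ-right (proj₁ bj)
  ... | before ibj = ⊥-elim (b≢u (B-antisym′ buj (B-inner (B-sym bui) ibj)))
  ... | between bij with minj _ bi bui bij
  ...   | inj₁ i≡u = ⊥-elim (u≢i (sym i≡u))
  ...   | inj₂ i≡j = i≡j
  cover-unique b≢u (bi , bui , u≢i , mini) (bj , buj , u≢j , minj) | after bji with mini _ bj buj bji
  ...   | inj₁ j≡u = ⊥-elim (u≢j (sym j≡u))
  ...   | inj₂ j≡i = sym j≡i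

  above-cover : ∀ {b u x p} → Arc b u → Cover b u x → Arc b p → B b u p → u ≡ p ⊎ B b x p
  above-cover (ebu , _) (bx , bux , _ , minx) bp bup with onLine (proj₁ bx) ∈ℓ-right (proj₁ bp)
  ... | before xbp = ⊥-elim (E-distinct ebu (B-antisym′ bup (B-inner (B-sym bux) xbp)))
  ... | between bxp = inj₂ bxp
  ... | after bpx with minx _ bp bup bpx
  ...   | inj₁ p≡u = inj₁ (sym p≡u)
  ...   | inj₂ refl = inj₂ (B-sym B-refl)

  record Siblings (b x u v : V) : Set where
    field
      arcˡ   : Arc b u
      arcʳ   : Arc b v
      coverˡ : Cover b u x
      coverʳ : Cover b v x
      u≢v    : u ≢ v

    b≢u : b ≢ u
    b≢u = E-distinct (proj₁ arcˡ)
    b≢v : b ≢ v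
    b≢v = E-distinct (proj₁ arcʳ)
    b≢x : b ≢ x
    b≢x = E-distinct (proj₁ (proj₁ coverˡ))
    bux : B b u x
    bux = proj₁ (proj₂ coverˡ)
    bvx : B b v x
    bvx = proj₁ (proj₂ coverʳ)

    -- On one side of `b`, the farther of the two ends would lie between the nearer one and the
    -- common cover `x`, against minimality.
    star : B u b v
    star with onLine (proj₁ arcˡ) ∈ℓ-right (proj₁ arcʳ)
    ... | before ubv = ubv
    ... | between buv with proj₂ (proj₂ (proj₂ coverˡ)) _ arcʳ buv bvx
    ...   | inj₁ v≡u = ⊥-elim (u≢v (sym v≡u))
    ...   | inj₂ v≡x = ⊥-elim (proj₁ (proj₂ (proj₂ coverʳ)) v≡x)
    star | after bvu with proj₂ (proj₂ (proj₂ coverʳ)) _ arcˡ bvu bux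
    ...   | inj₁ u≡v = ⊥-elim (u≢v u≡v)
    ...   | inj₂ u≡x = ⊥-elim (proj₁ (proj₂ (proj₂ coverˡ)) u≡x)

    centre : ∀ {c} → B c b u → B c b v → c ∈ℓ (u , v) → c ≡ b
    centre cbu cbv c∈ with star-noncollinear cbu star cbv c∈
    ... | inj₁ c≡b = c≡b
    ... | inj₂ (inj₁ u≡b) = ⊥-elim (b≢u (sym u≡b))
    ... | inj₂ (inj₂ v≡b) = ⊥-elim (b≢v (sym v≡b))

    comparable : ∀ {p} → Arc b p → p ∈ℓ (u , v) → (B b u p ⊎ B b p u) ⊎ (B b v p ⊎ B b p v)
    comparable (ebp , _) p∈ with onLine ebp ∈ℓ-right (proj₁ arcˡ) | onLine ebp ∈ℓ-right (proj₁ arcʳ)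
    ... | between bpu | _ = inj₁ (inj₂ bpu)
    ... | after bup | _ = inj₁ (inj₁ bup)
    ... | _ | between bpv = inj₂ (inj₂ bpv)
    ... | _ | after bvp = inj₂ (inj₁ bvp)
    ... | before pbu | before pbv = ⊥-elim (E-distinct ebp (sym (centre pbu pbv p∈)))

  Siblings-sym : ∀ {b x u v} → Siblings b x u v → Siblings b x v u
  Siblings-sym s = record
    { arcˡ = arcʳ ; arcʳ = arcˡ ; coverˡ = coverʳ ; coverʳ = coverˡ ; u≢v = ≢-sym u≢v }
    where open Siblings s

  module SiblingLines {b x u v c y p q} (s : Siblings b x u v) (t : Siblings c y p q)
    (uv⊆pq : ∀ {w} → w ∈ℓ (u , v) → w ∈ℓ (p , q))
    (pq⊆uv : ∀ {w} → w ∈ℓ (p , q) → w ∈ℓ (u , v)) where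

    private
      module s = Siblings s
      module t = Siblings t

    -- The point `b` is placed on the line `cy`. If it is between `c` and `y`, then `c` sees `u` and
    -- `v` through `b` and equals it by `centre`; if `c` is between `b` and `y`, the roles are
    -- exchanged. Beyond `y` only `b ≡ y` survives, which is the first case.
    same-near : b ≡ c
    same-near = go (onLine (proj₁ s.arcˡ) ∈ℓ-left (proj₁ (proj₁ t.coverˡ)))
      where
      inside : B c b y → b ≡ c
      inside cby = sym (s.centre (B-inner ocb (proj₂ s.arcˡ)) (B-inner ocb (proj₂ s.arcʳ))
                                 (pq⊆uv (between t.star)))
        where ocb = B-inner′ (proj₂ (proj₁ t.coverˡ)) cby
      go : b ∈ℓ (c , y) → b ≡ c
      go (before bcy) = t.centre (B-inner′ bcy t.bux) (B-inner′ bcy t.bvx) (uv⊆pq (between s.star))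
      go (between cby) = inside cby
      go (after cyb) with uv⊆pq (between s.star)
      ... | before bpq = ⊥-elim (t.b≢v (B-antisym t.star (B-inner bpq (B-sym (B-outer t.bvx cyb)))))
      ... | after pqb = ⊥-elim (t.b≢u (B-antisym (B-sym t.star)
                          (B-inner (B-sym pqb) (B-sym (B-outer t.bux cyb)))))
      ... | between pbq = inside (subst (B c b) b≡y (B-sym B-refl))
        where b≡y = B-antisym (B-sym (B-inner (B-inner t.bux cyb) pbq)) (B-inner t.bvx cyb)

  -- Were `p` beyond `x`, then `q`, being comparable with `u` or `v`, would lie below `p` or beyond
  -- `x` too; but `p` and `q` see each other through `b`.
  not-above : ∀ {b x u v y p q} → Siblings b x u v → Siblings b y p q → q ∈ℓ (u , v) → ¬ B b x p
  not-above {b} {x} {u} {v} {y} {p} {q} s t q∈ bxp = go (s.comparable t.arcʳ q∈)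
    where
    module s = Siblings s
    module t = Siblings t
    ¬bqp : ¬ B b q p
    ¬bqp bqp = t.b≢v (B-antisym′ bqp (B-sym t.star))
    clash : ∀ {w} → Arc b w → Cover b w x → B b w q ⊎ B b q w → ⊥
    clash aw cw (inj₂ bqw) = ¬bqp (B-outer (B-outer bqw (proj₁ (proj₂ cw))) bxp)
    clash aw cw (inj₁ bwq) with above-cover aw cw t.arcʳ bwq
    ... | inj₁ refl = ¬bqp (B-outer (proj₁ (proj₂ cw)) bxp)
    ... | inj₂ bxq = s.b≢x (B-antisym′ bxq (B-inner (B-sym bxp) t.star))
    go : (B b u q ⊎ B b q u) ⊎ (B b v q ⊎ B b q v) → ⊥
    go (inj₁ r) = clash s.arcˡ s.coverˡ r
    go (inj₂ r) = clash s.arcʳ s.coverʳ r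

  -- Once `b ≡ c`, the end `p` is comparable with `u` or `v`. Equal ends have equal covers;
  -- otherwise the upper end lies beyond the cover of the lower one, which `not-above` forbids.
  sibling-lines : ∀ {b x u v c y p q} → Siblings b x u v → Siblings c y p q →
                  (∀ {w} → w ∈ℓ (u , v) → w ∈ℓ (p , q)) → (∀ {w} → w ∈ℓ (p , q) → w ∈ℓ (u , v)) →
                  b ≡ c × x ≡ y
  sibling-lines {b} {x} {u} {v} {c} {y} {p} {q} s t f g with SiblingLines.same-near s t f g
  ... | refl = refl , go (s.comparable t.arcˡ (g ∈ℓ-left))
    where
    module s = Siblings s
    module t = Siblings t
    shared : ∀ {w w′} → Siblings b x w w′ → w′ ∈ℓ (p , q) → q ∈ℓ (w , w′) → B b w p ⊎ B b p w → x ≡ y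
    shared r w′∈ q∈ (inj₁ bwp) with above-cover r.arcˡ r.coverˡ t.arcˡ bwp
      where module r = Siblings r
    ... | inj₁ refl = cover-unique t.b≢u (Siblings.coverˡ r) t.coverˡ
    ... | inj₂ bxp = ⊥-elim (not-above r t q∈ bxp)
    shared r w′∈ q∈ (inj₂ bpw) with above-cover t.arcˡ t.coverˡ (Siblings.arcˡ r) bpw
    ... | inj₁ refl = cover-unique t.b≢u (Siblings.coverˡ r) t.coverˡ
    ... | inj₂ byw = ⊥-elim (not-above t r w′∈ byw)
    go : (B b u p ⊎ B b p u) ⊎ (B b v p ⊎ B b p v) → x ≡ y
    go (inj₁ r) = shared s (f ∈ℓ-right) (g ∈ℓ-right) r
    go (inj₂ r) = shared (Siblings-sym s) (f ∈ℓ-left) (∈ℓ-flip (g ∈ℓ-right)) r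

  -- Three siblings pairwise see each other through `b`, so they cannot be collinear.
  no-third-sibling : ∀ {b x u v p} → Siblings b x u v → Siblings b x p u → Siblings b x p v →
                     ¬ p ∈ℓ (u , v)
  no-third-sibling s t r p∈ =
    Siblings.b≢u t (sym (Siblings.centre s (Siblings.star t) (Siblings.star r) p∈))

-- Counting lists by fibres and labels.

module _ {A : Set} where

  length-split : {P Q : A → Set} (P? : Decidable P) (Q? : Decidable Q) (xs : List A) →
                 (∀ {x} → x ∈ xs → P x ⊎ Q x) →
                 length xs ≤ length (filter P? xs) + length (filter Q? xs)
  length-split P? Q? [] h = z≤n
  length-split P? Q? (x ∷ xs) h with P? x | Q? x | length-split P? Q? xs (h ∘ there)
  ... | yes _ | yes _ | ih = s≤s (ℕ.≤-trans ih (ℕ.+-monoʳ-≤ (length (filter P? xs)) (ℕ.n≤1+n _)))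
  ... | yes _ | no _  | ih = s≤s ih
  ... | no _  | yes _ | ih = ℕ.≤-trans (s≤s ih) (ℕ.≤-reflexive (sym (ℕ.+-suc (length (filter P? xs)) _)))
  ... | no ¬p | no ¬q | ih with h (here refl)
  ...   | inj₁ p = ⊥-elim (¬p p)
  ...   | inj₂ q = ⊥-elim (¬q q)

  length-filter-filter : {P Q : A → Set} (P? : Decidable P) (Q? : Decidable Q) (xs : List A) →
                         length (filter P? (filter Q? xs)) ≤ length (filter P? xs)
  length-filter-filter P? Q? [] = z≤n
  length-filter-filter P? Q? (x ∷ xs) with Q? x
  ... | yes _ with P? x
  ...   | yes _ = s≤s (length-filter-filter P? Q? xs)
  ...   | no _  = length-filter-filter P? Q? xs
  length-filter-filter P? Q? (x ∷ xs) | no _ with P? x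
  ...   | yes _ = ℕ.m≤n⇒m≤1+n (length-filter-filter P? Q? xs)
  ...   | no _  = length-filter-filter P? Q? xs

  length-filter-⊎ : {P Q : A → Set} (P? : Decidable P) (Q? : Decidable Q) (xs : List A) →
                    length (filter (λ x → P? x ⊎-dec Q? x) xs) ≤
                    length (filter P? xs) + length (filter Q? xs)
  length-filter-⊎ P? Q? xs = ℕ.≤-trans
    (length-split P? Q? (filter P∪Q? xs) (λ x∈ → proj₂ (∈-filter⁻ P∪Q? {xs = xs} x∈)))
    (ℕ.+-mono-≤ (length-filter-filter P? P∪Q? xs) (length-filter-filter Q? P∪Q? xs))
    where P∪Q? = λ x → P? x ⊎-dec Q? x

  length≤1 : {xs : List A} → Unique xs → (∀ {x y} → x ∈ xs → y ∈ xs → x ≡ y) → length xs ≤ 1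
  length≤1 [] h = z≤n
  length≤1 (_ ∷ []) h = s≤s z≤n
  length≤1 ((x≢y ∷ _) ∷ _ ∷ _) h = ⊥-elim (x≢y (h (here refl) (there (here refl))))

  module _ {C : Set} (_≟C_ : DecidableEquality C) (f : A → C) where

    length-fibres : ∀ {k} (ys : List C) (xs : List A) → (∀ {x} → x ∈ xs → f x ∈ ys) →
                    (∀ y → length (filter (λ x → f x ≟C y) xs) ≤ k) → length xs ≤ length ys * k
    length-fibres [] [] _ _ = z≤n
    length-fibres [] (x ∷ xs) f∈ _ with f∈ (here refl)
    ... | ()
    length-fibres {k} (y ∷ ys) xs f∈ fibre = ℕ.≤-trans
      (length-split (λ x → f x ≟C y) (λ x → ¬? (f x ≟C y)) xs (λ {x} _ → toSum (f x ≟C y)))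
      (ℕ.+-mono-≤ (fibre y) (length-fibres ys rest rest∈ λ y′ →
        ℕ.≤-trans (length-filter-filter (λ x → f x ≟C y′) (λ x → ¬? (f x ≟C y)) xs) (fibre y′)))
      where
      rest = filter (λ x → ¬? (f x ≟C y)) xs
      rest∈ : ∀ {x} → x ∈ rest → f x ∈ ys
      rest∈ x∈ with ∈-filter⁻ (λ x → ¬? (f x ≟C y)) {xs = xs} x∈
      ... | x∈xs , fx≢y with f∈ x∈xs
      ...   | here fx≡y = ⊥-elim (fx≢y fx≡y)
      ...   | there fx∈ = fx∈

    length-injective : (ys : List C) {xs : List A} → Unique xs → (∀ {x} → x ∈ xs → f x ∈ ys) →
                       (∀ {x x′} → x ∈ xs → x′ ∈ xs → f x ≡ f x′ → x ≡ x′) →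
                       length xs ≤ length ys
    length-injective ys {xs} uniq f∈ inj = ℕ.≤-trans
      (length-fibres ys xs f∈ λ y → length≤1 (filter⁺ (λ x → f x ≟C y) uniq) λ x∈ x′∈ →
        let (x∈xs , fx≡y) = ∈-filter⁻ (λ x → f x ≟C y) {xs = xs} x∈
            (x′∈xs , fx′≡y) = ∈-filter⁻ (λ x → f x ≟C y) {xs = xs} x′∈
        in inj x∈xs x′∈xs (trans fx≡y (sym fx′≡y)))
      (ℕ.≤-reflexive (ℕ.*-identityʳ (length ys)))

  length-label-fibres : ∀ {m k} (f : A → Fin m) (xs : List A) →
                        (∀ j → length (filter (λ x → f x ≟ j) xs) ≤ k) → length xs ≤ m * k
  length-label-fibres {m} {k} f xs fibre = ℕ.≤-trans
    (length-fibres _≟_ f (allFin m) xs (λ _ → ∈-allFin _) fibre)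
    (ℕ.≤-reflexive (cong (_* k) (length-tabulate {n = m} id)))

  length-labels : ∀ {m} (f : A → Fin m) {xs : List A} → Unique xs →
                  (∀ {x x′} → x ∈ xs → x′ ∈ xs → f x ≡ f x′ → x ≡ x′) → length xs ≤ m
  length-labels {m} f uniq inj = ℕ.≤-trans
    (length-injective _≟_ f (allFin m) uniq (λ _ → ∈-allFin _) inj)
    (ℕ.≤-reflexive (length-tabulate {n = m} id))

-- The default is the value at points outside `F`, where nothing is claimed.
choose : {X A : Set} {F : X → Set} {Q : X → A → Set} → Decidable F → A →
         (∀ x → F x → ∃ (Q x)) → ∃ λ (g : X → A) → ∀ x → F x → Q x (g x)
choose {A = A} {F} {Q} F? default h = (λ x → value x (F? x)) , λ x fx → valid x fx (F? x)
  where
  value : ∀ x → Dec (F x) → A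
  value x (yes p) = proj₁ (h x p)
  value x (no _)  = default
  valid : ∀ x → F x → (d : Dec (F x)) → Q x (value x d)
  valid x fx (yes p) = proj₂ (h x p)
  valid x fx (no ¬p) = ⊥-elim (¬p fx)

-- At most 2m far ends for one line and one root.

module Labelled {n m : ℕ} (β : Betweenness (Fin n)) (B? : ∀ a b c → Dec (Betweenness.B β a b c))
  (ℓ : Fin n → Fin n → Fin m) (ℓ-line : Betweenness.Respects β ℓ)
  (nonuniversal : Betweenness.Nonuniversal β) where

  open Betweenness β

  V : Set
  V = Fin n

  ∈ℓ? : ∀ p a b → Dec (p ∈ℓ (a , b))
  ∈ℓ? p a b = B? p a b ⊎-dec (B? a p b ⊎-dec B? a b p)

  -- The order from `r` is only partial, so the search keeps its candidate below the given `i`; this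
  -- is where `oUi` comes from.
  lowest : (r : V) {P : V → Set} → Decidable P → ∀ {i} → P i →
           ∃ λ x → P x × B r x i × (∀ w → P w → B r w x → w ≡ x)
  lowest r {P} P? Pi with go (allFin n) Pi
    where
    go : ∀ ws {i} → P i → ∃ λ x → P x × B r x i × (∀ {w} → w ∈ ws → P w → B r w x → w ≡ x)
    go [] {i} Pi = i , Pi , B-sym B-refl , λ ()
    go (v ∷ ws) Pi with go ws Pi
    ... | x , Px , rxi , least with P? v | B? r v x
    ...   | no ¬Pv | _ = x , Px , rxi , λ
      { (here refl) Pw _ → ⊥-elim (¬Pv Pw) ; (there w∈) → least w∈ }
    ...   | yes _ | no ¬rvx = x , Px , rxi , λ
      { (here refl) _ rwx → ⊥-elim (¬rvx rwx) ; (there w∈) → least w∈ }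
    ...   | yes Pv | yes rvx = v , Pv , B-outer rvx rxi , λ
      { (here refl) _ _ → refl
      ; (there w∈) Pw rwv → let w≡x = least w∈ Pw (B-outer rwv rvx) in
          B-antisym rwv (subst (B r v) (sym w≡x) rvx) }
  ... | x , Px , rxi , least = x , Px , rxi , λ w → least (∈-allFin w)

  module Root (λ₀ : Fin m) (o : V) where

    E : V → V → Set
    E a b = a ≢ b × ℓ a b ≡ λ₀

    E? : ∀ a b → Dec (E a b)
    E? a b = ¬? (a ≟ b) ×-dec (ℓ a b ≟ λ₀)

    E-same : ∀ {a b c d p} → E a b → E c d → p ∈ℓ (a , b) → p ∈ℓ (c , d)
    E-same (a≢b , ab) (c≢d , cd) = ℓ-line a≢b c≢d (trans ab (sym cd))

    open Rooted β E proj₁ E-same o public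

    Arc? : ∀ b u → Dec (Arc b u)
    Arc? b u = E? b u ×-dec B? o b u

    Beyond : V → V → V → Set
    Beyond b u i = Arc b i × B b u i × u ≢ i

    Beyond? : ∀ b u i → Dec (Beyond b u i)
    Beyond? b u i = Arc? b i ×-dec (B? b u i ×-dec ¬? (u ≟ i))

    Far : V → Set
    Far u = ∃ λ b → Arc b u × ∃ (Beyond b u)

    Far? : Decidable Far
    Far? u = any? λ b → Arc? b u ×-dec any? (Beyond? b u)

    covered : ∀ {b u i} → Arc b u → Beyond b u i → ∃ (Cover b u)
    covered {b} {u} bu bui with lowest b (Beyond? b u) bui
    ... | i , (bi , bui , u≢i) , _ , least = i , bi , bui , u≢i , minimal
      where
      minimal : ∀ w → Arc b w → B b u w → B b w i → w ≡ u ⊎ w ≡ i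
      minimal w bw buw bwi with u ≟ w
      ... | yes u≡w = inj₁ (sym u≡w)
      ... | no u≢w  = inj₂ (least w (bw , buw , u≢w) bwi)

    Next : V → V → Set
    Next u w = (∃ λ c → Arc c w × Aligned c u w) × B o u w × u ≢ w

    Next? : ∀ u w → Dec (Next u w)
    Next? u w = any? (λ c → Arc? c w ×-dec (B? c u w ⊎-dec B? u c w))
                ×-dec (B? o u w ×-dec ¬? (u ≟ w))

    -- z misses L; if z is on the line uU, no edge of L fits between u and U, so a point y of L
    -- off the line uU cannot branch off between u and i.
    exotic-kind : ∀ {b u i d U y z} → Arc b u → Arc b i → B b u i → Arc d U → Aligned d u U →
                  B o u U → B o U i → ¬ z ∈ℓ (b , i) → z ∈ℓ (u , U) → ¬ y ∈ℓ (u , U) → OnLine y →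
                  B y b u × B b y i
    exotic-kind {b} {u} {i} {d} {U} {y} {z}
      (ebu , obu) (ebi , obi) bui (edU , odU) dU ouU oUi z∉bi z∈uU y∉uU ony =
      go (ony ebu) (ony ebi)
      where
      buU = B-inner obu ouU
      bUi = B-inner (B-outer obu ouU) oUi
      uUi = B-inner buU bUi
      dUi = B-inner odU oUi
      b≢u = proj₁ ebu
      z∉dU : ¬ z ∈ℓ (d , U)
      z∉dU z∈ = z∉bi (onLine edU z∈ ebi)
      apart : z ∈ℓ (u , U) → ¬ B u d U
      apart (before zuU)  udU = z∉dU (before (B-outer′ zuU udU))
      apart (between uzU) _   = z∉bi (between (B-outer′ bui (B-outer uzU uUi)))
      apart (after uUz)   udU = z∉dU (after (B-inner udU uUz))
      -- With `d` behind `u`, every position of `y` on the line `dU` puts it on `uU`.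
      past : B d u U → B u y i → ¬ y ∈ℓ (d , U)
      past duU uyi y∈ = side y∈
        where
        duy = B-inner′ (B-outer duU dUi) uyi
        side : ¬ y ∈ℓ (d , U)
        side (before ydU)  = y∉uU (subst (λ x → y ∈ℓ (x , U)) (B-antisym (B-inner′ ydU duU) (B-sym duy)) y∈)
        side (between dyU) = y∉uU (between (B-inner duy dyU))
        side (after dUy)   = y∉uU (after (B-inner duU dUy))
      ¬uyi : Aligned d u U → ¬ B u y i
      ¬uyi (inj₁ duU) uyi = past duU uyi (ony edU)
      ¬uyi (inj₂ udU) _   = apart z∈uU udU
      go : y ∈ℓ (b , u) → y ∈ℓ (b , i) → B y b u × B b y i
      go (between byu) _ = ⊥-elim (y∉uU (before (B-inner byu buU)))
      go (before ybu) (before ybi) = ⊥-elim (y∉uU (before (B-outer′ (B-inner′ ybi bUi) buU)))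
      go (before ybu) (between byi) = ybu , byi
      go (before ybu) (after biy) = ⊥-elim (b≢u (B-antisym ybu (B-sym (B-outer bui biy))))
      go (after buy) (before ybi) = ⊥-elim (b≢u (B-antisym (B-inner′ ybi bui) (B-sym buy)))
      go (after buy) (between byi) = ⊥-elim (¬uyi dU (B-inner buy byi))
      go (after buy) (after biy) = ⊥-elim (y∉uU (after (B-inner buU (B-outer bUi biy))))

    -- The point `y` has to miss `uU`. A point `z` off L is taken if it does; otherwise another
    -- point off `uU` is taken, which is off L or exotic by `exotic-kind`.
    step : ∀ u → Far u → ∃ λ ((b , i , y) : V × V × V) → Step b u i y
    step u (b , bu , _ , beyond) with covered bu beyond
    ... | i , cover@(bi , bui , u≢i , _)
      -- The cover `i` is itself a candidate for the next end.
      with lowest o (Next? u) ((b , bi , inj₁ bui) , B-outer′ (proj₂ bi) bui , u≢i)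
    ...   | U , ((d , dU , aligned) , ouU , u≢U) , oUi , least = finish (nonuniversal (proj₁ (proj₁ bi)))
      where
      build : ∀ {y} → ¬ y ∈ℓ (u , U) → Kind b u i y → ∃ λ ((b , i , y) : V × V × V) → Step b u i y
      build {y} y∉uU kind = (b , i , y) , record
        { arc = bu ; cover = cover ; U = U ; u≢U = u≢U ; ouU = ouU ; oUi = oUi
        ; onU = onLine (proj₁ dU) ∈ℓ-right
        ; minimal = minimal ; y∉uU = y∉uU ; kind = kind }
        where
        minimal : ∀ w c → Arc c w → Aligned c u w → B o u w → B o w U → w ≡ u ⊎ w ≡ U
        minimal w c cw cuw ouw owU with u ≟ w
        ... | yes u≡w = inj₁ (sym u≡w)
        ... | no u≢w  = inj₂ (least w ((c , cw , cuw) , ouw , u≢w) owU)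
      off : ∀ {p} → ¬ p ∈ℓ (b , i) → ∀ {a c} → E a c → ¬ p ∈ℓ (a , c)
      off p∉ e p∈ = p∉ (onLine e p∈ (proj₁ bi))
      finish : (∃ λ z → ¬ z ∈ℓ (b , i)) → ∃ λ ((b , i , y) : V × V × V) → Step b u i y
      finish (z , z∉) with ∈ℓ? z u U
      ... | no z∉uU = build z∉uU (inj₁ (off z∉))
      ... | yes z∈uU with nonuniversal u≢U
      ...   | y , y∉uU with ∈ℓ? y b i
      ...     | no y∉bi = build y∉uU (inj₁ (off y∉bi))
      ...     | yes y∈bi = build y∉uU (inj₂ (ony ,
                  exotic-kind bu bi bui dU aligned ouU oUi z∉ z∈uU y∉uU ony))
        where ony = onLine (proj₁ bi) y∈bi

    far : List V
    far = filter Far? (allFin n)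

    far-unique : Unique far
    far-unique = filter⁺ Far? (allFin⁺ n)

    ∈-far : ∀ {u} → u ∈ far → Far u
    ∈-far u∈ = proj₂ (∈-filter⁻ Far? {xs = allFin n} u∈)

    -- `key u` holds the near end and the cover of `u`, `off u` the point `y` of its step; `leader`
    -- picks one far end for each key.
    module Assignment (key : V → V × V) (off : V → V)
      (stepAt : ∀ {u} → Far u → Step (proj₁ (key u)) u (proj₂ (key u)) (off u))
      (leader : V × V → V)
      (leader-far : ∀ {u} → Far u → Far (leader (key u)))
      (leader-key : ∀ {u} → Far u → key (leader (key u)) ≡ key u) where

      rep : V → V
      rep u = leader (key u)

      Leads? : Decidable (λ u → rep u ≡ u)
      Leads? u = rep u ≟ u

      leaders followers : List V
      leaders   = filter Leads? far
      followers = filter (¬? ∘ Leads?) far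

      key-injective : ∀ {u v} → Far u → Far v → u ≢ v → ℓ (off u) u ≡ ℓ (off v) v → key u ≡ key v
      key-injective fu fv u≢v eq
        with collision su sv u≢v (ℓ-line su.y≢u sv.y≢u eq) (ℓ-line sv.y≢u su.y≢u (sym eq))
        where
        su = stepAt fu
        sv = stepAt fv
        module su = Step su
        module sv = Step sv
      ... | b≡c , i≡j = cong₂ _,_ b≡c i≡j

      -- By `collision`, distinct far ends with the same assigned line have the same key, and
      -- leaders with the same key coincide.
      leaders-bound : length leaders ≤ m
      leaders-bound = length-labels (λ u → ℓ (off u) u) (filter⁺ Leads? far-unique) injective
        where
        injective : ∀ {u v} → u ∈ leaders → v ∈ leaders → ℓ (off u) u ≡ ℓ (off v) v → u ≡ v
        injective {u} {v} u∈ v∈ eq with u ≟ v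
        ... | yes u≡v = u≡v
        ... | no u≢v with ∈-filter⁻ Leads? {xs = far} u∈ | ∈-filter⁻ Leads? {xs = far} v∈
        ...   | u∈far , ru≡u | v∈far , rv≡v = trans (sym ru≡u)
                (trans (cong leader (key-injective (∈-far u∈far) (∈-far v∈far) u≢v eq)) rv≡v)

      siblings : ∀ {u v} → Far u → Far v → key v ≡ key u → u ≢ v →
                 Siblings (proj₁ (key u)) (proj₂ (key u)) u v
      siblings {u} {v} fu fv eq u≢v = record
        { arcˡ = su.arc ; coverˡ = su.cover ; u≢v = u≢v
        ; arcʳ = subst (λ k → Arc (proj₁ k) v) eq sv.arc
        ; coverʳ = subst (λ k → Cover (proj₁ k) v (proj₂ k)) eq sv.cover }
        where
        module su = Step (stepAt fu)
        module sv = Step (stepAt fv)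

      -- By `sibling-lines`, the line joining a follower to its leader determines the key, hence the
      -- leader; a second follower on that line would be a third sibling.
      followers-bound : length followers ≤ m
      followers-bound = length-labels (λ u → ℓ u (rep u)) (filter⁺ (¬? ∘ Leads?) far-unique) injective
        where
        injective : ∀ {u p} → u ∈ followers → p ∈ followers → ℓ u (rep u) ≡ ℓ p (rep p) → u ≡ p
        injective {u} {p} u∈ p∈ eq with u ≟ p
        ... | yes u≡p = u≡p
        ... | no u≢p with ∈-filter⁻ (¬? ∘ Leads?) {xs = far} u∈ | ∈-filter⁻ (¬? ∘ Leads?) {xs = far} p∈
        ...   | u∈far , ru≢u | p∈far , rp≢p
          with sibling-lines s t (ℓ-line (≢-sym ru≢u) (≢-sym rp≢p) eq)
                                 (ℓ-line (≢-sym rp≢p) (≢-sym ru≢u) (sym eq))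
          where
          fu = ∈-far u∈far
          fp = ∈-far p∈far
          s = siblings fu (leader-far fu) (leader-key fu) (≢-sym ru≢u)
          t = siblings fp (leader-far fp) (leader-key fp) (≢-sym rp≢p)
        ...     | b≡c , x≡y = ⊥-elim (no-third-sibling
                    (siblings fu (leader-far fu) (leader-key fu) (≢-sym ru≢u))
                    (within (siblings fp fu same (≢-sym u≢p)))
                    (within (subst (Siblings (proj₁ (key p)) (proj₂ (key p)) p) (sym rep≡)
                              (siblings fp (leader-far fp) (leader-key fp) (≢-sym rp≢p))))
                    (ℓ-line (≢-sym rp≢p) (≢-sym ru≢u) (sym eq) ∈ℓ-left))
          where
          fu = ∈-far u∈far
          fp = ∈-far p∈far
          same : key u ≡ key p
          same = cong₂ _,_ b≡c x≡y
          rep≡ : rep u ≡ rep p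
          rep≡ = cong leader same
          within : ∀ {v} → Siblings (proj₁ (key p)) (proj₂ (key p)) p v →
                   Siblings (proj₁ (key u)) (proj₂ (key u)) p v
          within {v} = subst (λ k → Siblings (proj₁ k) (proj₂ k) p v) (sym same)

      bound : length far ≤ m + m
      bound = ℕ.≤-trans (length-split Leads? (¬? ∘ Leads?) far λ {u} _ → toSum (Leads? u))
                            (ℕ.+-mono-≤ leaders-bound followers-bound)

    far-bound : length far ≤ m + m
    far-bound with choose Far? (o , o , o) step
    -- The leader is a function of the key, so that ends with equal keys share it.
    ... | g , steps with choose {F = λ k → ∃ λ u → Far u × (proj₁ (g u) , proj₁ (proj₂ (g u))) ≡ k}
                                {Q = λ k u → Far u × (proj₁ (g u) , proj₁ (proj₂ (g u))) ≡ k}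
          (λ k → any? λ u → Far? u ×-dec ≡-dec _≟_ _≟_ _ k) o (λ _ h → h)
    ...   | leader , leads = Assignment.bound
      (λ u → proj₁ (g u) , proj₁ (proj₂ (g u))) (λ u → proj₂ (proj₂ (g u))) (λ {u} → steps u) leader
      (λ fu → proj₁ (leads _ (_ , fu , refl))) (λ fu → proj₂ (leads _ (_ , fu , refl)))

-- Counting all ordered pairs of points.

length-square : ∀ {A : Set} (xs ys : List A) → length (cartesianProduct xs ys) ≡ length xs * length ys
length-square [] ys = refl
length-square (x ∷ xs) ys = trans (length-++ (map (x ,_) ys))
  (cong₂ _+_ (length-map (x ,_) ys) (length-square xs ys))

swap≤2 : ∀ {n} {xs : List (Fin n × Fin n)} → Unique xs →
         (∀ {p q} → p ∈ xs → q ∈ xs → q ≡ p ⊎ q ≡ swap p) → length xs ≤ 2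
swap≤2 {xs = []} _ _ = z≤n
swap≤2 {xs = p ∷ xs} uniq h = length-injective (≡-dec _≟_ _≟_) id (p ∷ swap p ∷ []) uniq
  (λ q∈ → place (h (here refl) q∈)) (λ _ _ e → e)
  where
  place : ∀ {q} → q ≡ p ⊎ q ≡ swap p → q ∈ p ∷ swap p ∷ []
  place (inj₁ refl) = here refl
  place (inj₂ refl) = there (here refl)

-- The bound `r` on the size of a star, of order √m, is specified by the inequality that
-- `star-bound` produces.
module PairCount {n m : ℕ} (β : Betweenness (Fin n)) (B? : ∀ a b c → Dec (Betweenness.B β a b c))
  (ℓ : Fin n → Fin n → Fin m) (ℓ-line : Betweenness.Respects β ℓ)
  (ℓ-sym : ∀ {a b} → a ≢ b → ℓ a b ≡ ℓ b a)
  (nonuniversal : Betweenness.Nonuniversal β) (extremal : Betweenness.Extremal β)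
  (r : ℕ) (r-bound : ∀ s → s * s ≤ s + m * 2 → s ≤ r) where

  open Betweenness β
  open Labelled β B? ℓ ℓ-line nonuniversal

  label : V × V → Fin m
  label (a , x) = ℓ a x

  Longer : V → V → V → Set
  Longer a x y = a ≢ y × ℓ a y ≡ ℓ a x × B a x y × x ≢ y

  Longer? : ∀ a x y → Dec (Longer a x y)
  Longer? a x y = ¬? (a ≟ y) ×-dec (ℓ a y ≟ ℓ a x ×-dec (B? a x y ×-dec ¬? (x ≟ y)))

  -- Ext₂ makes the first extension ay extendable in turn: a diametral point is only kept out of
  -- the interior of extendable segments, and it must stay out of both ax and ay.
  Ext₁ Ext₂ : V → V → Set
  Ext₁ a x = ∃ (Longer a x)
  Ext₂ a x = ∃ λ y → Longer a x y × Ext₁ a y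

  Ext₁? : ∀ a x → Dec (Ext₁ a x)
  Ext₁? a x = any? (Longer? a x)

  Ext₂? : ∀ a x → Dec (Ext₂ a x)
  Ext₂? a x = any? λ y → Longer? a x y ×-dec Ext₁? a y

  -- Any two points of an antichain see each other through a, so they span pairwise distinct lines.
  star-bound : ∀ a j {xs} → Unique xs → (∀ {x} → x ∈ xs → a ≢ x × ℓ a x ≡ j) →
               (∀ {x y} → x ∈ xs → y ∈ xs → x ≢ y → ¬ B a x y) → length xs ≤ r
  star-bound a j {xs} uniq same antichain = r-bound (length xs) (ℕ.≤-trans
    (ℕ.≤-reflexive (sym (length-square xs xs)))
    (ℕ.≤-trans (length-split diag? (¬? ∘ diag?) pairs (λ {p} _ → toSum (diag? p)))
      (ℕ.+-mono-≤ diag-bound off-bound)))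
    where
    pairs = cartesianProduct xs xs
    pairs-unique = cartesianProduct⁺ uniq uniq
    diag? : Decidable (λ (p : V × V) → proj₁ p ≡ proj₂ p)
    diag? (x , y) = x ≟ y
    off = filter (¬? ∘ diag?) pairs

    diag-bound : length (filter diag? pairs) ≤ length xs
    diag-bound = length-injective _≟_ proj₁ xs (filter⁺ diag? pairs-unique)
      (λ p∈ → proj₁ (∈-cartesianProduct⁻ xs xs (proj₁ (∈-filter⁻ diag? {xs = pairs} p∈))))
      λ p∈ q∈ e → cong₂ _,_ e (trans (sym (proj₂ (∈-filter⁻ diag? {xs = pairs} p∈)))
                                (trans e (proj₂ (∈-filter⁻ diag? {xs = pairs} q∈))))

    star : ∀ {x y} → x ∈ xs → y ∈ xs → x ≢ y → B x a y
    star {x} {y} x∈ y∈ x≢y with same x∈ | same y∈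
    ... | a≢x , ax | a≢y , ay with ℓ-line a≢x a≢y (trans ax (sym ay)) ∈ℓ-right
    ...   | before xay  = xay
    ...   | between axy = ⊥-elim (antichain x∈ y∈ x≢y axy)
    ...   | after ayx   = ⊥-elim (antichain y∈ x∈ (≢-sym x≢y) ayx)

    endpoint : ∀ {x y p} → x ∈ xs → y ∈ xs → p ∈ xs → x ≢ y → p ∈ℓ (x , y) → p ≡ x ⊎ p ≡ y
    endpoint {x} {y} {p} x∈ y∈ p∈ x≢y pxy with p ≟ x | p ≟ y
    ... | yes e | _ = inj₁ e
    ... | _ | yes e = inj₂ e
    ... | no p≢x | no p≢y
      with star-noncollinear (star p∈ x∈ p≢x) (star x∈ y∈ x≢y) (star p∈ y∈ p≢y) pxy
    ...   | inj₁ p≡a = ⊥-elim (proj₁ (same p∈) (sym p≡a))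
    ...   | inj₂ (inj₁ x≡a) = ⊥-elim (proj₁ (same x∈) (sym x≡a))
    ...   | inj₂ (inj₂ y≡a) = ⊥-elim (proj₁ (same y∈) (sym y≡a))

    matched : ∀ {x y p q} → p ≢ q → p ≡ x ⊎ p ≡ y → q ≡ x ⊎ q ≡ y →
              (p , q) ≡ (x , y) ⊎ (p , q) ≡ (y , x)
    matched p≢q (inj₁ refl) (inj₁ refl) = ⊥-elim (p≢q refl)
    matched p≢q (inj₁ refl) (inj₂ refl) = inj₁ refl
    matched p≢q (inj₂ refl) (inj₁ refl) = inj₂ refl
    matched p≢q (inj₂ refl) (inj₂ refl) = ⊥-elim (p≢q refl)

    -- A line joining two points of the antichain contains no third one, by `endpoint`, so it
    -- determines the pair; the 2 counts its two orders.
    off-bound : length off ≤ m * 2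
    off-bound = length-label-fibres label off λ k →
      swap≤2 (filter⁺ (λ p → label p ≟ k) (filter⁺ (¬? ∘ diag?) pairs-unique)) λ {p} {q} p∈ q∈ →
      let (p∈off , p≡k) = ∈-filter⁻ (λ p → label p ≟ k) {xs = off} p∈
          (q∈off , q≡k) = ∈-filter⁻ (λ p → label p ≟ k) {xs = off} q∈
          (p∈pairs , p≢) = ∈-filter⁻ (¬? ∘ diag?) {xs = pairs} p∈off
          (q∈pairs , q≢) = ∈-filter⁻ (¬? ∘ diag?) {xs = pairs} q∈off
          (p₁∈ , p₂∈) = ∈-cartesianProduct⁻ xs xs p∈pairs
          (q₁∈ , q₂∈) = ∈-cartesianProduct⁻ xs xs q∈pairs
          same-line = trans q≡k (sym p≡k)
      in matched q≢ (endpoint p₁∈ p₂∈ q₁∈ p≢ (ℓ-line q≢ p≢ same-line ∈ℓ-left))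
                    (endpoint p₁∈ p₂∈ q₂∈ p≢ (ℓ-line q≢ p≢ same-line ∈ℓ-right))

  Short : V → V → Set
  Short a x = a ≢ x × ¬ Ext₂ a x

  Short? : ∀ a x → Dec (Short a x)
  Short? a x = ¬? (a ≟ x) ×-dec ¬? (Ext₂? a x)

  Short∩? : ∀ a j x → Dec (Short a x × ℓ a x ≡ j)
  Short∩? a j x = Short? a x ×-dec (ℓ a x ≟ j)

  shorts : V → Fin m → List V
  shorts a j = filter (Short∩? a j) (allFin n)

  ∈-shorts : ∀ {a j x} → x ∈ shorts a j → Short a x × ℓ a x ≡ j
  ∈-shorts {a} {j} x∈ = proj₂ (∈-filter⁻ (Short∩? a j) {xs = allFin n} x∈)

  -- Splitting by `Ext₁` leaves two antichains: `B a x y` would give `x` the property `Ext₂` in the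
  -- first part and `Ext₁` in the second.
  shorts-bound : ∀ a j → length (shorts a j) ≤ r + r
  shorts-bound a j = ℕ.≤-trans
    (length-split (Ext₁? a) (¬? ∘ Ext₁? a) (shorts a j) (λ {x} _ → toSum (Ext₁? a x)))
    (ℕ.+-mono-≤
      (star-bound a j (filter⁺ (Ext₁? a) unique) (λ x∈ → on (proj₁ (second x∈))) λ x∈ y∈ x≢y axy →
        proj₂ (proj₁ (∈-shorts (proj₁ (second x∈))))
          (_ , longer (proj₁ (second x∈)) (proj₁ (second y∈)) x≢y axy , proj₂ (second y∈)))
      (star-bound a j (filter⁺ (¬? ∘ Ext₁? a) unique) (λ x∈ → on (proj₁ (top x∈))) λ x∈ y∈ x≢y axy →
        proj₂ (top x∈) (_ , longer (proj₁ (top x∈)) (proj₁ (top y∈)) x≢y axy)))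
    where
    unique = filter⁺ (Short∩? a j) (allFin⁺ n)
    second : ∀ {x} → x ∈ filter (Ext₁? a) (shorts a j) → x ∈ shorts a j × Ext₁ a x
    second = ∈-filter⁻ (Ext₁? a) {xs = shorts a j}
    top : ∀ {x} → x ∈ filter (¬? ∘ Ext₁? a) (shorts a j) → x ∈ shorts a j × ¬ Ext₁ a x
    top = ∈-filter⁻ (¬? ∘ Ext₁? a) {xs = shorts a j}
    on : ∀ {x} → x ∈ shorts a j → a ≢ x × ℓ a x ≡ j
    on x∈ = proj₁ (proj₁ (∈-shorts x∈)) , proj₂ (∈-shorts x∈)
    longer : ∀ {x y} → x ∈ shorts a j → y ∈ shorts a j → x ≢ y → B a x y → Longer a x y
    longer x∈ y∈ x≢y axy = proj₁ (on y∈) , trans (proj₂ (on y∈)) (sym (proj₂ (on x∈))) , axy , x≢y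

  pairs : List (V × V)
  pairs = cartesianProduct (allFin n) (allFin n)

  pairs-unique : Unique pairs
  pairs-unique = cartesianProduct⁺ (allFin⁺ n) (allFin⁺ n)

  ∈-pairs : ∀ p → p ∈ pairs
  ∈-pairs p = ∈-cartesianProduct⁺ (∈-allFin (proj₁ p)) (∈-allFin (proj₂ p))

  bad? : Decidable (λ (p : V × V) → Short (proj₁ p) (proj₂ p))
  bad? p = Short? (proj₁ p) (proj₂ p)

  bad : List (V × V)
  bad = filter bad? pairs

  bad-bound : length bad ≤ n * (m * (r + r))
  bad-bound = subst (λ k → length bad ≤ k * (m * (r + r))) (length-tabulate {n = n} id)
    (length-fibres _≟_ proj₁ (allFin n) bad (λ _ → ∈-allFin _) λ a →
      length-label-fibres label (from a) λ j → ℕ.≤-trans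
        (length-injective _≟_ proj₂ (shorts a j)
          (filter⁺ (label? j) (filter⁺ (from? a) (filter⁺ bad? pairs-unique)))
          (λ p∈ → into p∈)
          (λ p∈ q∈ e → cong₂ _,_ (trans (start p∈) (sym (start q∈))) e))
        (shorts-bound a j))
    where
    from? : ∀ a → Decidable (λ (p : V × V) → proj₁ p ≡ a)
    from? a p = proj₁ p ≟ a
    label? : ∀ j → Decidable (λ p → label p ≡ j)
    label? j p = label p ≟ j
    from : V → List (V × V)
    from a = filter (from? a) bad
    split : ∀ {a j p} → p ∈ filter (label? j) (from a) → (p ∈ bad × proj₁ p ≡ a) × label p ≡ j
    split {a} {j} p∈ = let (p∈from , eq) = ∈-filter⁻ (label? j) {xs = from a} p∈
                       in ∈-filter⁻ (from? a) {xs = bad} p∈from , eq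
    start : ∀ {a j p} → p ∈ filter (label? j) (from a) → proj₁ p ≡ a
    start p∈ = proj₂ (proj₁ (split p∈))
    into : ∀ {a j p} → p ∈ filter (label? j) (from a) → proj₂ p ∈ shorts a j
    into {a} {j} {p} p∈ with split p∈
    ... | (p∈bad , refl) , eq =
      ∈-filter⁺ (Short∩? a j) (∈-allFin _) (proj₂ (∈-filter⁻ bad? {xs = pairs} p∈bad) , eq)

  -- Both directions are required: which end points away from `o` is known only once `o` is chosen,
  -- and counting the near ends reverses the pair.
  Good : V × V → Set
  Good (b , u) = b ≢ u × Ext₂ b u × Ext₂ u b

  good? : Decidable Good
  good? (b , u) = ¬? (b ≟ u) ×-dec (Ext₂? b u ×-dec Ext₂? u b)

  good : List (V × V)
  good = filter good? pairs

  Good-swap : ∀ {p} → Good p → Good (swap p)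
  Good-swap (b≢u , bu , ub) = ≢-sym b≢u , ub , bu

  module Class (j : Fin m) where

    class? : Decidable (λ p → label p ≡ j)
    class? p = label p ≟ j

    class : List (V × V)
    class = filter class? good

    class-unique : Unique class
    class-unique = filter⁺ class? (filter⁺ good? pairs-unique)

    ∈-class⁻ : ∀ {p} → p ∈ class → Good p × label p ≡ j
    ∈-class⁻ p∈ = let (p∈good , eq) = ∈-filter⁻ class? {xs = good} p∈
                  in proj₂ (∈-filter⁻ good? {xs = pairs} p∈good) , eq

    ∈-class⁺ : ∀ {p} → Good p → label p ≡ j → p ∈ class
    ∈-class⁺ {p} g eq = ∈-filter⁺ class? (∈-filter⁺ good? (∈-pairs p) g) eq

    Endpoint : V → Set
    Endpoint a = ∃ λ x → a ≢ x × ℓ a x ≡ j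

    Endpoint? : Decidable Endpoint
    Endpoint? a = any? λ x → ¬? (a ≟ x) ×-dec (ℓ a x ≟ j)

    endpointʳ : ∀ {a x} → a ≢ x → ℓ a x ≡ j → Endpoint x
    endpointʳ a≢x eq = _ , ≢-sym a≢x , trans (sym (ℓ-sym a≢x)) eq

    -- With the root moved to `u`, the arc `ub` starts at the root itself, so it points away
    -- trivially.
    fibre-far : ∀ {b u} → Good (b , u) → ℓ b u ≡ j → Root.Far j u b
    fibre-far {b} {u} (b≢u , _ , (x , (u≢x , ux , ubx , b≢x) , _)) eq =
      u , ((≢-sym b≢u , ub) , B-refl) , x , ((u≢x , trans ux ub) , B-refl) , ubx , b≢x
      where ub = trans (sym (ℓ-sym b≢u)) eq

    module Centre (o p : V) (Po : Endpoint o) (Pp : Endpoint p)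
      (extreme : ∀ {b u w} → Endpoint b → Endpoint u → Endpoint w → B b u w → u ≢ w →
                 p ∈ℓ (b , u) → B b o u → o ≡ b ⊎ o ≡ u) where

      on : ∀ {q b u} → Endpoint q → b ≢ u → ℓ b u ≡ j → q ∈ℓ (b , u)
      on (_ , q≢x , qx) b≢u bu = ℓ-line q≢x b≢u (trans qx (sym bu)) ∈ℓ-left

      -- For `u` to be far, the extension `bx` must still point away from `o`; the further extension
      -- `w` keeps `o` out of the interior of `bx`.
      outward : ∀ {b u} → Good (b , u) → ℓ b u ≡ j → B o b u → Root.Far j o u
      outward {b} {u} (b≢u , (x , (b≢x , bx , bux , u≢x) , (w , (b≢w , bw , bxw , x≢w))) , _) eq obu =
        b , ((b≢u , eq) , obu) , x , ((b≢x , bx′) , obx (on Po b≢x bx′)) , bux , u≢x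
        where
        bx′ = trans bx eq
        bw′ = trans bw bx′
        obx : o ∈ℓ (b , x) → B o b x
        obx (before obx) = obx
        obx (after bxo) = ⊥-elim (b≢u (B-antisym obu (B-sym (B-outer bux bxo))))
        obx (between box) with extreme (x , b≢x , bx′) (endpointʳ b≢x bx′) (endpointʳ b≢w bw′)
                                       bxw x≢w (on Pp b≢x bx′) box
        ... | inj₁ refl = B-refl
        ... | inj₂ refl = ⊥-elim (b≢u (B-antisym obu (B-sym bux)))

      oriented : ∀ {b u} → Good (b , u) → ℓ b u ≡ j → B o b u ⊎ B o u b
      oriented {b} {u} (b≢u , (x , (b≢x , bx , bux , u≢x) , _) , _) eq with on Po b≢u eq
      ... | before obu = inj₁ obu
      ... | after buo = inj₂ (B-sym buo)
      ... | between bou with extreme (u , b≢u , eq) (endpointʳ b≢u eq)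
                                     (endpointʳ b≢x (trans bx eq)) bux u≢x (on Pp b≢u eq) bou
      ...   | inj₁ refl = inj₁ B-refl
      ...   | inj₂ refl = inj₂ B-refl

      out? : Decidable (λ (q : V × V) → B o (proj₁ q) (proj₂ q))
      out? (b , u) = B? o b u

      in? : Decidable (λ (q : V × V) → B o (proj₂ q) (proj₁ q))
      in? (b , u) = B? o u b

      out : List (V × V)
      out = filter out? class

      ∈-out⁻ : ∀ {q} → q ∈ out → q ∈ class × B o (proj₁ q) (proj₂ q)
      ∈-out⁻ = ∈-filter⁻ out? {xs = class}

      out-unique : Unique out
      out-unique = filter⁺ out? class-unique

      -- Seen from `o` there are at most 2m ends `u`; seen from each such `u`, the starts `b` are
      -- far ends in turn, again at most 2m.
      out-bound : length out ≤ (m + m) * (m + m)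
      out-bound = ℕ.≤-trans
        (length-fibres _≟_ proj₂ (Root.far j o) out
          (λ q∈ → let (q∈class , obu) = ∈-out⁻ q∈ ; (g , eq) = ∈-class⁻ q∈class
                  in ∈-filter⁺ (Root.Far? j o) (∈-allFin _) (outward g eq obu))
          λ u → ℕ.≤-trans
            (length-injective _≟_ proj₁ (Root.far j u) (filter⁺ (to? u) out-unique)
              (λ q∈ → into q∈)
              (λ p∈ q∈ e → cong₂ _,_ e (trans (end p∈) (sym (end q∈)))))
            (Root.far-bound j u))
        (ℕ.*-monoˡ-≤ (m + m) (Root.far-bound j o))
        where
        to? : ∀ u → Decidable (λ (q : V × V) → proj₂ q ≡ u)
        to? u q = proj₂ q ≟ u
        end : ∀ {u q} → q ∈ filter (to? u) out → proj₂ q ≡ u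
        end {u} q∈ = proj₂ (∈-filter⁻ (to? u) {xs = out} q∈)
        into : ∀ {u q} → q ∈ filter (to? u) out → proj₁ q ∈ Root.far j u
        into {u} q∈ with ∈-filter⁻ (to? u) {xs = out} q∈
        ... | q∈out , refl = let (g , eq) = ∈-class⁻ (proj₁ (∈-out⁻ q∈out))
                             in ∈-filter⁺ (Root.Far? j u) (∈-allFin _) (fibre-far g eq)

      in-bound : length (filter in? class) ≤ length out
      in-bound = length-injective (≡-dec _≟_ _≟_) swap out (filter⁺ in? class-unique)
        (λ q∈ → let (q∈class , oub) = ∈-filter⁻ in? {xs = class} q∈ ; (g , eq) = ∈-class⁻ q∈class
                in ∈-filter⁺ out? (∈-class⁺ (Good-swap g) (trans (sym (ℓ-sym (proj₁ g))) eq)) oub)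
        (λ _ _ e → cong swap e)

      class-bound′ : length class ≤ (m + m) * (m + m) + (m + m) * (m + m)
      class-bound′ = ℕ.≤-trans
        (length-split out? in? class λ q∈ → let (g , eq) = ∈-class⁻ q∈ in oriented g eq)
        (ℕ.+-mono-≤ out-bound (ℕ.≤-trans in-bound out-bound))

    class-bound : length class ≤ (m + m) * (m + m) + (m + m) * (m + m)
    class-bound with any? Endpoint?
    ... | yes nonempty = let (o , p , Po , Pp , extreme) = extremal Endpoint? nonempty
                         in Centre.class-bound′ o p Po Pp extreme
    ... | no empty = ℕ.≤-trans (ℕ.≤-reflexive (cong length (none class ∈-class⁻))) z≤n
      where
      none : ∀ xs → (∀ {p} → p ∈ xs → Good p × label p ≡ j) → xs ≡ []
      none [] _ = refl
      none (p ∷ _) h = let ((b≢u , _) , eq) = h (here refl) in ⊥-elim (empty (_ , _ , b≢u , eq))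

  good-bound : length good ≤ m * ((m + m) * (m + m) + (m + m) * (m + m))
  good-bound = length-label-fibres label good Class.class-bound

  -- A pair is diagonal, short in one of its two directions, or good; the four summands bound these
  -- in turn.
  pair-count : n * n ≤ n + (n * (m * (r + r)) +
                 (n * (m * (r + r)) + m * ((m + m) * (m + m) + (m + m) * (m + m))))
  pair-count = begin
    n * n              ≡⟨ cong₂ _*_ (length-tabulate {n = n} id) (length-tabulate {n = n} id) ⟨
    _                  ≡⟨ length-square (allFin n) (allFin n) ⟨
    length pairs       ≤⟨ length-split diag? rest? pairs (λ {p} _ → classify p) ⟩
    _                  ≤⟨ ℕ.+-mono-≤ diag-bound (ℕ.≤-trans (length-filter-⊎ bad? reversed-or-good? pairs)
                            (ℕ.+-mono-≤ bad-bound (ℕ.≤-trans (length-filter-⊎ reversed? good? pairs)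
                              (ℕ.+-mono-≤ reversed-bound good-bound)))) ⟩
    _                  ∎
    where
    open ℕ.≤-Reasoning
    diag? : Decidable (λ (p : V × V) → proj₁ p ≡ proj₂ p)
    diag? (x , y) = x ≟ y
    reversed? : Decidable (λ (p : V × V) → Short (proj₂ p) (proj₁ p))
    reversed? p = bad? (swap p)
    reversed-or-good? : Decidable (λ (p : V × V) → Short (proj₂ p) (proj₁ p) ⊎ Good p)
    reversed-or-good? p = reversed? p ⊎-dec good? p
    rest? : Decidable (λ (p : V × V) → Short (proj₁ p) (proj₂ p) ⊎
                                       (Short (proj₂ p) (proj₁ p) ⊎ Good p))
    rest? p = bad? p ⊎-dec reversed-or-good? p

    classify : ∀ p → proj₁ p ≡ proj₂ p ⊎
               (Short (proj₁ p) (proj₂ p) ⊎ (Short (proj₂ p) (proj₁ p) ⊎ Good p))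
    classify (x , y) with x ≟ y
    ... | yes e = inj₁ e
    ... | no x≢y with Ext₂? x y | Ext₂? y x
    ...   | no ¬xy | _ = inj₂ (inj₁ (x≢y , ¬xy))
    ...   | yes _ | no ¬yx = inj₂ (inj₂ (inj₁ (≢-sym x≢y , ¬yx)))
    ...   | yes xy | yes yx = inj₂ (inj₂ (inj₂ (x≢y , xy , yx)))

    diag-bound : length (filter diag? pairs) ≤ n
    diag-bound = subst (length (filter diag? pairs) ≤_) (length-tabulate {n = n} id)
      (length-injective _≟_ proj₁ (allFin n) (filter⁺ diag? pairs-unique) (λ _ → ∈-allFin _)
        λ p∈ q∈ e → cong₂ _,_ e (trans (sym (proj₂ (∈-filter⁻ diag? {xs = pairs} p∈)))
                                  (trans e (proj₂ (∈-filter⁻ diag? {xs = pairs} q∈)))))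

    reversed-bound : length (filter reversed? pairs) ≤ n * (m * (r + r))
    reversed-bound = ℕ.≤-trans
      (length-injective (≡-dec _≟_ _≟_) swap bad (filter⁺ reversed? pairs-unique)
        (λ {p} p∈ → ∈-filter⁺ bad? (∈-pairs (swap p)) (proj₂ (∈-filter⁻ reversed? {xs = pairs} p∈)))
        (λ _ _ e → cong swap e))
      bad-bound

-- Betweenness from distances in an ordered monoid.

record OrderedMonoid : Set₁ where
  infix 4 _≼_
  infixl 6 _⊕_
  field
    Carrier  : Set
    _≼_      : Carrier → Carrier → Set
    _⊕_      : Carrier → Carrier → Carrier
    𝟘        : Carrier
    ≼-refl   : ∀ {x} → x ≼ x
    ≼-trans  : ∀ {x y z} → x ≼ y → y ≼ z → x ≼ z
    ⊕-mono   : ∀ {x y u v} → x ≼ y → u ≼ v → x ⊕ u ≼ y ⊕ v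
    ⊕-cancel : ∀ {x y z} → x ⊕ y ≼ x ⊕ z → y ≼ z
    ⊕-assoc  : ∀ {x y z} → x ⊕ (y ⊕ z) ≼ (x ⊕ y) ⊕ z
    ⊕-comm   : ∀ {x y} → x ⊕ y ≼ y ⊕ x
    ⊕-zeroˡ  : ∀ {x} → 𝟘 ⊕ x ≼ x
    ⊕-zeroʳ  : ∀ {x} → x ≼ x ⊕ 𝟘

  ⊕-exchange : ∀ {x y u v} → (x ⊕ y) ⊕ (u ⊕ v) ≼ (x ⊕ u) ⊕ (y ⊕ v)
  ⊕-exchange = ≼-trans ⊕-assoc (≼-trans (⊕-mono step ≼-refl) unassoc)
    where
    unassoc : ∀ {x y z} → (x ⊕ y) ⊕ z ≼ x ⊕ (y ⊕ z)
    unassoc = ≼-trans ⊕-comm (≼-trans ⊕-assoc (≼-trans ⊕-comm (≼-trans ⊕-assoc ⊕-comm)))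
    step : ∀ {x y u} → (x ⊕ y) ⊕ u ≼ (x ⊕ u) ⊕ y
    step = ≼-trans unassoc (≼-trans (⊕-mono ≼-refl ⊕-comm) ⊕-assoc)

  ⊕-cancel-zero : ∀ {x y} → x ⊕ y ≼ x → y ≼ 𝟘
  ⊕-cancel-zero h = ⊕-cancel (≼-trans h ⊕-zeroʳ)

  ⊕-nonneg : ∀ {x y} → 𝟘 ≼ y → x ≼ x ⊕ y
  ⊕-nonneg 0≼y = ≼-trans ⊕-zeroʳ (⊕-mono ≼-refl 0≼y)

record IsDistance (M : OrderedMonoid) {V : Set} (d : V → V → OrderedMonoid.Carrier M) : Set where
  open OrderedMonoid M
  field
    d-sym    : ∀ {a b} → d a b ≼ d b a
    d-refl   : ∀ {a} → d a a ≼ 𝟘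
    d-nonneg : ∀ {a b} → 𝟘 ≼ d a b
    d-zero   : ∀ {a b} → d a b ≼ 𝟘 → a ≡ b
    triangle : ∀ {a b c} → d a c ≼ d a b ⊕ d b c

  -- Kept apart from the fields because real distances are comparable only under a double negation.
  Total : Set
  Total = ∀ a b c e → d a b ≼ d c e ⊎ d c e ≼ d a b

  -- One inequality replaces the equation; the other one is `triangle`.
  Between : V → V → V → Set
  Between a b c = d a b ⊕ d b c ≼ d a c

  betweenness : Betweenness V
  betweenness = record
    { B = Between
    ; B-sym = λ h → ≼-trans (⊕-mono d-sym d-sym) (≼-trans ⊕-comm (≼-trans h d-sym))
    ; B-refl = ≼-trans (⊕-mono d-refl ≼-refl) ⊕-zeroˡ
    ; B-outer = λ abc acd → ≼-trans (⊕-mono ≼-refl triangle)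
        (≼-trans ⊕-assoc (≼-trans (⊕-mono abc ≼-refl) acd))
    ; B-inner = λ abc acd → ⊕-cancel
        (≼-trans ⊕-assoc (≼-trans (⊕-mono abc ≼-refl) (≼-trans acd triangle)))
    ; B-antisym = λ abc acb → d-zero (≼-trans (⊕-nonneg d-nonneg) (⊕-cancel-zero
        (≼-trans ⊕-assoc (≼-trans (⊕-mono abc ≼-refl) acb))))
    }

-- A diametral pair is extremal.

module Diametral {M : OrderedMonoid} {n : ℕ} {d : Fin n → Fin n → OrderedMonoid.Carrier M}
  (distance : IsDistance M d) (total : IsDistance.Total distance) where

  open OrderedMonoid M
  open IsDistance distance
  open Betweenness betweenness

  private
    V = Fin n

  farthest : ∀ q qs → ∃ λ (x : V × V) → x ∈ q ∷ qs ×
             (∀ {y} → y ∈ q ∷ qs → d (proj₁ y) (proj₂ y) ≼ d (proj₁ x) (proj₂ x))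
  farthest q [] = q , here refl , λ { (here refl) → ≼-refl }
  farthest q (q′ ∷ qs) with farthest q′ qs
  ... | x , x∈ , far with total (proj₁ q) (proj₂ q) (proj₁ x) (proj₂ x)
  ...   | inj₁ q≼x = x , there x∈ , λ { (here refl) → q≼x ; (there y∈) → far y∈ }
  ...   | inj₂ x≼q = q , here refl , λ { (here refl) → ≼-refl ; (there y∈) → ≼-trans (far y∈) x≼q }

  diametral : {P : V → Set} (qs : List (V × V)) → (∀ {a b} → (a , b) ∈ qs → P a × P b) →
    (∀ {a b} → P a → P b → (a , b) ∈ qs) → ∃ P → ∃₂ λ o p → P o × P p ×
    (∀ {b u w} → P b → P u → P w → B b u w → u ≢ w → p ∈ℓ (b , u) → B b o u → o ≡ b ⊎ o ≡ u)
  diametral [] out into (a , Pa) with into Pa Pa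
  ... | ()
  diametral {P} (q ∷ qs) out into _ with farthest q qs
  ... | (o , p) , op∈ , far = o , p , proj₁ (out op∈) , proj₂ (out op∈) , extreme
    where
    diameter : ∀ {b u} → P b → P u → d b u ≼ d o p
    diameter Pb Pu = far (into Pb Pu)
    extreme : ∀ {b u w} → P b → P u → P w → B b u w → u ≢ w → p ∈ℓ (b , u) → B b o u → o ≡ b ⊎ o ≡ u
    -- Here `o` lies between `p` and `u`, so `pu` would exceed the diameter unless `o ≡ u`; the next
    -- case is its mirror image.
    extreme Pb Pu Pw buw u≢w (inj₁ pbu) bou =
      inj₂ (d-zero (⊕-cancel-zero (≼-trans (⊕-mono d-sym ≼-refl)
        (≼-trans (B-outer′ pbu bou) (≼-trans d-sym (diameter Pu (proj₂ (out op∈))))))))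
    extreme Pb Pu Pw buw u≢w (inj₂ (inj₂ bup)) bou =
      inj₁ (sym (d-zero (⊕-cancel-zero (≼-trans ⊕-comm
        (≼-trans (B-outer bou bup) (diameter Pb (proj₂ (out op∈))))))))
    extreme {b} {u} {w} Pb Pu Pw buw u≢w (inj₂ (inj₁ bpu)) bou = ⊥-elim (u≢w (d-zero d≼0))
      where
      -- d(b,u) + d(u,w) ≤ d(o,p), whereas p and o between b and u force 2 d(o,p) ≤ 2 d(b,u).
      D = d b u
      long : D ⊕ d u w ≼ d o p
      long = ≼-trans buw (diameter Pb Pw)
      short : d o p ⊕ d o p ≼ D ⊕ D
      short = ≼-trans (⊕-mono (triangle {b = b}) (triangle {b = u})) (≼-trans ⊕-exchange
        (⊕-mono (≼-trans (⊕-mono d-sym ≼-refl) bou) (≼-trans (⊕-mono ≼-refl d-sym) bpu)))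
      d≼0 : d u w ≼ 𝟘
      d≼0 = ≼-trans (⊕-nonneg d-nonneg)
        (⊕-cancel-zero (≼-trans ⊕-exchange (≼-trans (⊕-mono long long) short)))

  extremal : Extremal
  extremal {P} P? = diametral (filter P²? pairs)
    (λ {a} {b} ab∈ → proj₂ (∈-filter⁻ P²? {xs = pairs} ab∈))
    (λ Pa Pb → ∈-filter⁺ P²? (∈-cartesianProduct⁺ (∈-allFin _) (∈-allFin _)) (Pa , Pb))
    where
    P²? : Decidable (λ (q : V × V) → P (proj₁ q) × P (proj₂ q))
    P²? q = P? (proj₁ q) ×-dec P? (proj₂ q)
    pairs = cartesianProduct (allFin n) (allFin n)

-- The reals as an ordered monoid, total up to double negation.

infix 4 _≼_

-- A wrapper around _≤ℝ_ from which Agda can recover the two real numbers.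
record _≼_ (x y : ℝ) : Set where
  constructor ⌈_⌉
  field holds : x ≤ℝ y

≼-trans : ∀ {x y z} → x ≼ y → y ≼ z → x ≼ z
≼-trans {x} {y} {z} ⌈ p ⌉ ⌈ q ⌉ = ⌈ ≤ℝ-trans {x} {y} {z} p q ⌉

≈⇒≼ : ∀ {x y} → x ≈ℝ y → x ≼ y
≈⇒≼ {x} {y} p = ⌈ ≤ℝ-reflexive {x} {y} p ⌉

≈⇒≽ : ∀ {x y} → x ≈ℝ y → y ≼ x
≈⇒≽ {x} {y} p = ≈⇒≼ {y} {x} (≈ℝ-sym {x} {y} p)

p≤p+q : ∀ p {q} → 0ℚ ℚ.≤ q → p ℚ.≤ p ℚ.+ q
p≤p+q p 0≤q = ℚ.≤-trans (ℚ.≤-reflexive (sym (ℚ.+-identityʳ p))) (ℚ.+-monoʳ-≤ p 0≤q)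

≼-pointwise : ∀ {x y} → (∀ k → seq x k ℚ.≤ seq y k) → x ≼ y
≼-pointwise h = ⌈ (λ ε 0<ε → always λ k → ℚ.≤-trans (h k) (p≤p+q _ (ℚ.<⇒≤ 0<ε))) ⌉

≼-refl : ∀ {x} → x ≼ x
≼-refl = ≼-pointwise λ _ → ℚ.≤-refl

+-exchange : ∀ a b c d → (a ℚ.+ b) ℚ.+ (c ℚ.+ d) ≡ (a ℚ.+ c) ℚ.+ (b ℚ.+ d)
+-exchange = solve 4 (λ a b c d → (a :+ b) :+ (c :+ d) := (a :+ c) :+ (b :+ d)) refl
  where open +-*-Solver

+-mono-≼ : ∀ {x y u v} → x ≼ y → u ≼ v → x +ℝ u ≼ y +ℝ v
+-mono-≼ {x} {y} {u} {v} ⌈ p ⌉ ⌈ q ⌉ = ⌈ (λ ε 0<ε → eventually-zip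
  (λ {k} xy uv → ℚ.≤-trans (ℚ.+-mono-≤ xy uv) (ℚ.≤-reflexive
    (trans (+-exchange (seq y k) (½ ℚ.* ε) (seq v k) (½ ℚ.* ε)) (cong (seq y k ℚ.+ seq v k ℚ.+_) (½+½ ε)))))
  (p (½ ℚ.* ε) (0<½* 0<ε)) (q (½ ℚ.* ε) (0<½* 0<ε))) ⌉

+-cancelˡ-≤ : ∀ a {b c} → a ℚ.+ b ℚ.≤ a ℚ.+ c → b ℚ.≤ c
+-cancelˡ-≤ a {b} {c} h = subst₂ ℚ._≤_ (cancel a b) (cancel a c) (ℚ.+-monoʳ-≤ (ℚ.- a) h)
  where
  cancel : ∀ a b → ℚ.- a ℚ.+ (a ℚ.+ b) ≡ b
  cancel = solve 2 (λ a b → :- a :+ (a :+ b) := b) refl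
    where open +-*-Solver

+-cancelˡ-≼ : ∀ {x y z} → x +ℝ y ≼ x +ℝ z → y ≼ z
+-cancelˡ-≼ {x} {y} {z} ⌈ p ⌉ = ⌈ (λ ε 0<ε → eventually-map
  (λ {k} h → +-cancelˡ-≤ (seq x k) (ℚ.≤-trans h (ℚ.≤-reflexive (ℚ.+-assoc (seq x k) (seq z k) ε))))
  (p ε 0<ε)) ⌉

-- The gap q - (p + 2η) at a late index is a positive margin witnessing x < y.
≮⇒≽ : ∀ {x y} → ¬ (x <ℝ y) → y ≼ x
≮⇒≽ {x} {y} x≮y = ⌈ (λ ε 0<ε → compare ε 0<ε) ⌉
  where
  compare : ∀ ε → 0ℚ ℚ.< ε → Eventually (λ k → seq y k ℚ.≤ seq x k ℚ.+ ε)
  compare ε 0<ε with cauchy x (½ ℚ.* (½ ℚ.* ε)) (0<½* (0<½* 0<ε))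
                   | cauchy y (½ ℚ.* (½ ℚ.* ε)) (0<½* (0<½* 0<ε))
  ... | M , f | N , g = decide (seq y K ℚ.≤? seq x K ℚ.+ (η ℚ.+ η))
    where
    -- A quarter of `ε`: one for each of the two moves between `k` and `K`, and two for the
    -- comparison at `K`, whose failure must absorb the same two moves.
    η = ½ ℚ.* (½ ℚ.* ε)
    K = M ℕ.⊔ N
    late : ∀ {k} → K ℕ.≤ k → M ℕ.≤ k × N ℕ.≤ k
    late K≤k = ℕ.≤-trans (ℕ.m≤m⊔n M N) K≤k , ℕ.≤-trans (ℕ.m≤n⊔m M N) K≤k
    x-near : ∀ {k} → K ℕ.≤ k → ∣ seq x k ℚ.- seq x K ∣ ℚ.≤ η
    x-near K≤k = f _ _ (proj₁ (late K≤k)) (proj₁ (late ℕ.≤-refl))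
    y-near : ∀ {k} → K ℕ.≤ k → ∣ seq y k ℚ.- seq y K ∣ ℚ.≤ η
    y-near K≤k = g _ _ (proj₂ (late K≤k)) (proj₂ (late ℕ.≤-refl))
    rises : ∀ z {k} → ∣ seq z k ℚ.- seq z K ∣ ℚ.≤ η → seq z k ℚ.≤ seq z K ℚ.+ η
    rises z {k} = ∣-∣≤⇒≤+ {seq z k} {seq z K}
    falls : ∀ z {k} → ∣ seq z k ℚ.- seq z K ∣ ℚ.≤ η → seq z K ℚ.≤ seq z k ℚ.+ η
    falls z {k} near = ∣-∣≤⇒≤+ {seq z K} {seq z k} (subst (ℚ._≤ η) (∣-∣-comm (seq z k) (seq z K)) near)
    collect : ∀ a e → ((a ℚ.+ e) ℚ.+ (e ℚ.+ e)) ℚ.+ e ≡ a ℚ.+ ((e ℚ.+ e) ℚ.+ (e ℚ.+ e))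
    collect = solve 2 (λ a e → ((a :+ e) :+ (e :+ e)) :+ e := a :+ ((e :+ e) :+ (e :+ e))) refl
      where open +-*-Solver
    quarters : (η ℚ.+ η) ℚ.+ (η ℚ.+ η) ≡ ε
    quarters = trans (cong₂ ℚ._+_ (½+½ (½ ℚ.* ε)) (½+½ (½ ℚ.* ε))) (½+½ ε)
    gap : ∀ p q e → (p ℚ.+ e) ℚ.+ (q ℚ.- (p ℚ.+ (e ℚ.+ e))) ≡ q ℚ.- e
    gap = solve 3 (λ p q e → (p :+ e) :+ (q :+ :- (p :+ (e :+ e))) := q :+ :- e) refl
      where open +-*-Solver
    decide : Dec (seq y K ℚ.≤ seq x K ℚ.+ (η ℚ.+ η)) → Eventually (λ k → seq y k ℚ.≤ seq x k ℚ.+ ε)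
    decide (yes h) = K , λ k K≤k → begin
      seq y k                                   ≤⟨ rises y (y-near K≤k) ⟩
      seq y K ℚ.+ η                             ≤⟨ ℚ.+-monoˡ-≤ η h ⟩
      (seq x K ℚ.+ (η ℚ.+ η)) ℚ.+ η             ≤⟨ ℚ.+-monoˡ-≤ η (ℚ.+-monoˡ-≤ (η ℚ.+ η) (falls x (x-near K≤k))) ⟩
      ((seq x k ℚ.+ η) ℚ.+ (η ℚ.+ η)) ℚ.+ η     ≡⟨ collect (seq x k) η ⟩
      seq x k ℚ.+ ((η ℚ.+ η) ℚ.+ (η ℚ.+ η))     ≡⟨ cong (seq x k ℚ.+_) quarters ⟩
      seq x k ℚ.+ ε                             ∎
      where open ℚ.≤-Reasoning
    decide (no h) = ⊥-elim (x≮y (γ , 0<γ , K , λ k K≤k → begin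
      seq x k ℚ.+ γ                             ≤⟨ ℚ.+-monoˡ-≤ γ (rises x (x-near K≤k)) ⟩
      (seq x K ℚ.+ η) ℚ.+ γ                     ≡⟨ gap (seq x K) (seq y K) η ⟩
      seq y K ℚ.- η                             ≤⟨ ℚ.+-monoˡ-≤ (ℚ.- η) (falls y (y-near K≤k)) ⟩
      (seq y k ℚ.+ η) ℚ.- η                     ≡⟨ undo (seq y k) η ⟩
      seq y k                                   ∎))
      where
      open ℚ.≤-Reasoning
      γ = seq y K ℚ.- (seq x K ℚ.+ (η ℚ.+ η))
      0<γ : 0ℚ ℚ.< γ
      0<γ = subst (ℚ._< γ) (ℚ.+-inverseʳ (seq x K ℚ.+ (η ℚ.+ η)))
              (ℚ.+-monoˡ-< (ℚ.- (seq x K ℚ.+ (η ℚ.+ η))) (ℚ.≰⇒> h))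
      undo : ∀ a e → (a ℚ.+ e) ℚ.- e ≡ a
      undo = solve 2 (λ a e → (a :+ e) :+ :- e := a) refl
        where open +-*-Solver

<⇒≼ : ∀ {x y} → x <ℝ y → x ≼ y
<⇒≼ (ε , 0<ε , N , h) = ⌈ (λ δ 0<δ → N , λ k N≤k →
  ℚ.≤-trans (p≤p+q _ (ℚ.<⇒≤ 0<ε)) (ℚ.≤-trans (h k N≤k) (p≤p+q _ (ℚ.<⇒≤ 0<δ)))) ⌉

≼-total : ∀ x y → ¬ ¬ (x ≼ y ⊎ y ≼ x)
≼-total x y = ¬¬-map decide ¬¬-excluded-middle
  where
  decide : Dec (x <ℝ y) → x ≼ y ⊎ y ≼ x
  decide (yes x<y) = inj₁ (<⇒≼ x<y)
  decide (no x≮y)  = inj₂ (≮⇒≽ x≮y)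

ℝ-monoid : OrderedMonoid
ℝ-monoid = record
  { Carrier  = ℝ
  ; _≼_      = _≼_
  ; _⊕_      = _+ℝ_
  ; 𝟘        = 0ℝ
  ; ≼-refl   = ≼-refl
  ; ≼-trans  = ≼-trans
  ; ⊕-mono   = +-mono-≼
  ; ⊕-cancel = λ {x} {y} {z} → +-cancelˡ-≼ {x} {y} {z}
  ; ⊕-assoc  = λ {x} {y} {z} → ≼-pointwise λ k →
      ℚ.≤-reflexive (sym (ℚ.+-assoc (seq x k) (seq y k) (seq z k)))
  ; ⊕-comm   = λ {x} {y} → ≼-pointwise λ k → ℚ.≤-reflexive (ℚ.+-comm (seq x k) (seq y k))
  ; ⊕-zeroˡ  = λ {x} → ≼-pointwise λ k → ℚ.≤-reflexive (ℚ.+-identityˡ (seq x k))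
  ; ⊕-zeroʳ  = λ {x} → ≼-pointwise λ k → ℚ.≤-reflexive (sym (ℚ.+-identityʳ (seq x k)))
  }

-- Choosing one representative for each class.

module _ {A : Set} {R : A → A → Set} (R? : ∀ x y → Dec (R x y)) (R-refl : ∀ {x} → R x x)
  (R-sym : ∀ {x y} → R x y → R y x) where

  Representatives : List A → ℕ → Set
  Representatives xs m = ∃ λ (rep : Fin m → A) → (∀ i → rep i ∈ xs) ×
    (∀ i j → i ≢ j → ¬ R (rep i) (rep j)) × (∀ {x} → x ∈ xs → ∃ λ i → R x (rep i))

  representatives : ∀ xs → ∃ (Representatives xs)
  representatives [] = 0 , (λ ()) , (λ ()) , (λ ()) , λ ()
  representatives (x ∷ xs) with representatives xs
  ... | m , rep , rep∈ , distinct , covers with any? (λ i → R? x (rep i))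
  ...   | yes known = m , rep , there ∘ rep∈ , distinct , λ
    { (here refl) → known ; (there y∈) → covers y∈ }
  ...   | no new = suc m , rep′ , rep′∈ , distinct′ , covers′
    where
    rep′ : Fin (suc m) → A
    rep′ zero    = x
    rep′ (suc i) = rep i
    rep′∈ : ∀ i → rep′ i ∈ x ∷ xs
    rep′∈ zero    = here refl
    rep′∈ (suc i) = there (rep∈ i)
    distinct′ : ∀ i j → i ≢ j → ¬ R (rep′ i) (rep′ j)
    distinct′ zero zero 0≢0 _ = 0≢0 refl
    distinct′ zero (suc j) _ xj = new (j , xj)
    distinct′ (suc i) zero _ ix = new (i , R-sym ix)
    distinct′ (suc i) (suc j) i≢j = distinct i j (i≢j ∘ cong suc)
    covers′ : ∀ {y} → y ∈ x ∷ xs → ∃ λ i → R y (rep′ i)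
    covers′ (here refl) = zero , R-refl
    covers′ (there y∈) with covers y∈
    ... | i , yi = suc i , yi

-- Numerical estimates.

root : ∀ k → ∃ λ r → r * r ≤ k × k < suc r * suc r
root zero = 0 , z≤n , s≤s z≤n
root (suc k) with root k
... | r , lo , hi with suc r * suc r ℕ.≤? suc k
...   | yes p = suc r , p , ℕ.≤-<-trans hi (ℕ.*-mono-< (ℕ.n<1+n (suc r)) (ℕ.n<1+n (suc r)))
...   | no ¬p = r , ℕ.m≤n⇒m≤1+n lo , ℕ.≰⇒> ¬p

-- If `s` exceeded `r`, then 4m < s², so 2s² ≤ 2s + 4m < 2s + s². Hence s < 2 and s² < 4 ≤ 4m, a
-- contradiction.
star-root : ∀ m r → 1 ≤ m → m * 4 < suc r * suc r → ∀ s → s * s ≤ s + m * 2 → s ≤ r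
star-root m r 1≤m hi s h with s ℕ.≤? r
... | yes s≤r = s≤r
... | no s≰r = ⊥-elim (ℕ.<⇒≱ small (ℕ.≤-trans (ℕ.*-monoˡ-≤ 4 1≤m) (ℕ.≤-trans (ℕ.n≤1+n _) large)))
  where
  large : m * 4 < s * s
  large = ℕ.<-≤-trans hi (ℕ.*-mono-≤ (ℕ.≰⇒> s≰r) (ℕ.≰⇒> s≰r))
  double : s * s + s * s ≤ (s + s) + m * 4
  double = ℕ.≤-trans (ℕ.+-mono-≤ h h) (ℕ.≤-reflexive (eq s m))
    where
    eq : ∀ s m → (s + m * 2) + (s + m * 2) ≡ (s + s) + m * 4
    eq = solve-∀
  s<2 : s < 2
  s<2 = ℕ.≰⇒> λ 2≤s → ℕ.<⇒≱
    (ℕ.+-cancelʳ-< (s * s) (s * s) (s + s) (ℕ.≤-<-trans double (ℕ.+-monoʳ-< (s + s) large)))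
    (ℕ.≤-trans (ℕ.≤-reflexive (two s)) (ℕ.*-monoˡ-≤ s 2≤s))
    where
    two : ∀ s → s + s ≡ 2 * s
    two = solve-∀
  small : s * s < 4
  small = ℕ.*-mono-< s<2 s<2

-- Up to n = 9 m r the bound r² ≤ 4m gives n² ≤ 324 m³; beyond it the terms linear in n absorb
-- at most 5/9 of n², leaving n² ≤ 18 m³.  Both are at most 343 m³.
final-bound : ∀ n m r → 1 ≤ r → 1 ≤ m → r * r ≤ m * 4 →
  n * n ≤ n + (n * (m * (r + r)) + (n * (m * (r + r)) + m * ((m + m) * (m + m) + (m + m) * (m + m)))) →
  n * n ≤ (7 * m) ^ 3
final-bound n m r 1≤r 1≤m lo h with ℕ.≤-total n (9 * (m * r))
... | inj₁ n≤ = begin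
  n * n                            ≤⟨ ℕ.*-mono-≤ n≤ n≤ ⟩
  9 * (m * r) * (9 * (m * r))      ≡⟨ regroup m r ⟩
  81 * (m * m) * (r * r)           ≤⟨ ℕ.*-monoʳ-≤ (81 * (m * m)) lo ⟩
  81 * (m * m) * (m * 4)           ≡⟨ collect m ⟩
  324 * (m * m * m)                ≤⟨ ℕ.m≤n+m _ (19 * (m * m * m)) ⟩
  19 * (m * m * m) + 324 * (m * m * m) ≡⟨ cube m ⟩
  (7 * m) ^ 3                      ∎
  where
  open ℕ.≤-Reasoning
  regroup : ∀ m r → 9 * (m * r) * (9 * (m * r)) ≡ 81 * (m * m) * (r * r)
  regroup = solve-∀
  collect : ∀ m → 81 * (m * m) * (m * 4) ≡ 324 * (m * m * m)
  collect = solve-∀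
  cube : ∀ m → 19 * (m * m * m) + 324 * (m * m * m) ≡ (7 * m) * ((7 * m) * ((7 * m) * 1))
  cube = solve-∀
... | inj₂ 9q≤n = ℕ.*-cancelˡ-≤ 4 (begin
  4 * (n * n)                      ≤⟨ ℕ.+-cancelˡ-≤ (5 * (n * n)) (4 * (n * n)) (72 * (m * m * m)) nine ⟩
  72 * (m * m * m)                 ≤⟨ ℕ.m≤n+m _ (1300 * (m * m * m)) ⟩
  1300 * (m * m * m) + 72 * (m * m * m) ≡⟨ cube m ⟩
  4 * (7 * m) ^ 3                  ∎)
  where
  open ℕ.≤-Reasoning
  q = m * r
  expand : ∀ n m r → n + (n * (m * (r + r)) + (n * (m * (r + r)) + m * ((m + m) * (m + m) + (m + m) * (m + m)))) ≡
           n * 1 + 4 * (n * (m * r)) + 8 * (m * m * m)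
  expand = solve-∀
  scale : ∀ n q t → 9 * (n * q + 4 * (n * q) + 8 * t) ≡ 5 * (n * (9 * q)) + 72 * t
  scale = solve-∀
  cube : ∀ m → 1300 * (m * m * m) + 72 * (m * m * m) ≡ 4 * ((7 * m) * ((7 * m) * ((7 * m) * 1)))
  cube = solve-∀
  nine : 5 * (n * n) + 4 * (n * n) ≤ 5 * (n * n) + 72 * (m * m * m)
  nine = begin
    5 * (n * n) + 4 * (n * n)                      ≡⟨ add (n * n) ⟩
    9 * (n * n)
      ≤⟨ ℕ.*-monoʳ-≤ 9 (ℕ.≤-trans h (ℕ.≤-reflexive (expand n m r))) ⟩
    9 * (n * 1 + 4 * (n * q) + 8 * (m * m * m))
      ≤⟨ ℕ.*-monoʳ-≤ 9 (ℕ.+-monoˡ-≤ (8 * (m * m * m))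
           (ℕ.+-monoˡ-≤ (4 * (n * q)) (ℕ.*-monoʳ-≤ n (ℕ.*-mono-≤ 1≤m 1≤r)))) ⟩
    9 * (n * q + 4 * (n * q) + 8 * (m * m * m))    ≡⟨ scale n q (m * m * m) ⟩
    5 * (n * (9 * q)) + 72 * (m * m * m)
      ≤⟨ ℕ.+-monoˡ-≤ (72 * (m * m * m)) (ℕ.*-monoʳ-≤ 5 (ℕ.*-monoʳ-≤ n 9q≤n)) ⟩
    5 * (n * n) + 72 * (m * m * m)                 ∎
    where
    add : ∀ t → 5 * t + 4 * t ≡ 9 * t
    add = solve-∀

-- Many lines in a decidable betweenness.

module Lines {n : ℕ} (β : Betweenness (Fin n)) (B? : ∀ a b c → Dec (Betweenness.B β a b c))
  (nonuniversal : Betweenness.Nonuniversal β) (extremal : Betweenness.Extremal β)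
  {x₀ y₀ : Fin n} (x₀≢y₀ : x₀ ≢ y₀) where

  open Betweenness β

  Pair : Set
  Pair = Fin n × Fin n

  Same : Pair → Pair → Set
  Same ab cd = ∀ p → (p ∈ℓ ab → p ∈ℓ cd) × (p ∈ℓ cd → p ∈ℓ ab)

  Same? : ∀ ab cd → Dec (Same ab cd)
  Same? ab cd = all? λ p → (on? p ab →-dec on? p cd) ×-dec (on? p cd →-dec on? p ab)
    where
    on? : ∀ p ab → Dec (p ∈ℓ ab)
    on? p (a , b) = B? p a b ⊎-dec (B? a p b ⊎-dec B? a b p)

  Same-sym : ∀ {ab cd} → Same ab cd → Same cd ab
  Same-sym s p = proj₂ (s p) , proj₁ (s p)

  proper? : Decidable (λ (p : Pair) → proj₁ p ≢ proj₂ p)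
  proper? (a , b) = ¬? (a ≟ b)

  properPairs : List Pair
  properPairs = filter proper? (cartesianProduct (allFin n) (allFin n))

  ∈-proper : ∀ {p} → proj₁ p ≢ proj₂ p → p ∈ properPairs
  ∈-proper ne = ∈-filter⁺ proper? (∈-cartesianProduct⁺ (∈-allFin _) (∈-allFin _)) ne

  many-lines : ∃ λ m → n * n ≤ (7 * m) ^ 3 × ∃ λ (rep : Fin m → Pair) →
    (∀ i → proj₁ (rep i) ≢ proj₂ (rep i)) × (∀ i j → i ≢ j → ¬ Same (rep i) (rep j))
  many-lines with representatives Same? (λ p → id , id) (λ {x} {y} → Same-sym {x} {y}) properPairs
  ... | m , rep , rep∈ , distinct , covers
    -- The line of `x₀` and `y₀` is the default label, given to pairs of equal points.
    with choose {F = λ (p : Pair) → proj₁ p ≢ proj₂ p} {Q = λ p i → Same p (rep i)} proper?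
           (proj₁ (covers (∈-proper x₀≢y₀))) (λ p ne → covers (∈-proper ne))
  ...   | label , same = m , bound , rep ,
          (λ i → proj₂ (∈-filter⁻ proper? {xs = cartesianProduct (allFin n) (allFin n)} (rep∈ i))) , distinct
    where
    ℓ : Fin n → Fin n → Fin m
    ℓ a b = label (a , b)
    ℓ-line : ∀ {a b c d p} → a ≢ b → c ≢ d → ℓ a b ≡ ℓ c d → p ∈ℓ (a , b) → p ∈ℓ (c , d)
    ℓ-line {a} {b} {c} {d} {p} a≢b c≢d eq p∈ = proj₂ (same (c , d) c≢d p)
      (subst (λ i → p ∈ℓ rep i) eq (proj₁ (same (a , b) a≢b p) p∈))
    ℓ-sym : ∀ {a b} → a ≢ b → ℓ a b ≡ ℓ b a
    ℓ-sym {a} {b} a≢b with ℓ a b ≟ ℓ b a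
    ... | yes eq = eq
    ... | no ne = ⊥-elim (distinct _ _ ne λ p →
      (proj₁ (same (b , a) (≢-sym a≢b) p) ∘ ∈ℓ-flip ∘ proj₂ (same (a , b) a≢b p)) ,
      (proj₁ (same (a , b) a≢b p) ∘ ∈ℓ-flip ∘ proj₂ (same (b , a) (≢-sym a≢b) p)))
    1≤m : 1 ≤ m
    1≤m = nonzero (ℓ x₀ y₀)
      where
      nonzero : ∀ {k} → Fin k → 1 ≤ k
      nonzero zero    = s≤s z≤n
      nonzero (suc _) = s≤s z≤n
    bound : n * n ≤ (7 * m) ^ 3
    -- `r` is the integer part of 2√m.
    bound with root (m * 4)
    ... | r , lo , hi = final-bound n m r 1≤r 1≤m lo
      (PairCount.pair-count β B? ℓ ℓ-line ℓ-sym nonuniversal extremal r (star-root m r 1≤m hi))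
      where
      1≤r : 1 ≤ r
      1≤r = ℕ.≮⇒≥ λ r<1 → ℕ.<⇒≱ hi (ℕ.≤-trans (ℕ.*-mono-≤ r<1 r<1)
              (ℕ.≤-trans 1≤m (ℕ.m≤m*n m 4)))

-- A number of lines computed from `n` alone, and its size.

Sufficient : ℕ → ℕ → Set
Sufficient n m = n * n ≤ (7 * m) ^ 3

-- The number of lines is announced outside the double negation, so it cannot depend on undecidable
-- facts about the metric. The least sufficient value depends on `n` only and is at most the true
-- number of lines.
least-sufficient : ∀ n m → Sufficient n m → ∃ λ m₀ → Sufficient n m₀ × (∀ m → Sufficient n m → m₀ ≤ m)
least-sufficient n zero h = zero , h , λ _ _ → z≤n
least-sufficient n (suc m) h with n * n ℕ.≤? (7 * m) ^ 3
... | yes p = least-sufficient n m p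
... | no ¬p = suc m , h , λ k q → ℕ.≰⇒> λ k≤m →
  ¬p (ℕ.≤-trans q (ℕ.^-monoˡ-≤ 3 (ℕ.*-monoʳ-≤ 7 k≤m)))

enough : ∀ n → Sufficient n n
enough zero = z≤n
enough n@(suc _) = ℕ.*-mono-≤ n≤7n (ℕ.≤-trans n≤7n (ℕ.m≤m*n (7 * n) (7 * n * 1)))
  where
  n≤7n : n ≤ 7 * n
  n≤7n = ℕ.m≤n*m n 7

seventh : ℚ.ℚ
seventh = ℤ.+ 1 ℚ./ 7

seventh-* : ∀ m → seventh ℚ.* (ℤ.+ (7 * m) ℚ./ 1) ≡ ℤ.+ m ℚ./ 1
seventh-* m = ℚ.toℚᵘ-injective (begin
  ℚ.toℚᵘ (seventh ℚ.* (ℤ.+ (7 * m) ℚ./ 1))             ≈⟨ ℚ.toℚᵘ-homo-* seventh (ℤ.+ (7 * m) ℚ./ 1) ⟩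
  ℚ.toℚᵘ seventh ℚᵘ.* ℚ.toℚᵘ (ℤ.+ (7 * m) ℚ./ 1)
    ≈⟨ ℚᵘ.*-congˡ {ℚ.toℚᵘ seventh} (ℚ.toℚᵘ-fromℚᵘ (ℚᵘ.mkℚᵘ (ℤ.+ (7 * m)) 0)) ⟩
  ℚ.toℚᵘ seventh ℚᵘ.* ℚᵘ.mkℚᵘ (ℤ.+ (7 * m)) 0           ≈⟨ ℚᵘ.*≡* eq ⟩
  ℚᵘ.mkℚᵘ (ℤ.+ m) 0                                    ≈⟨ ℚ.toℚᵘ-fromℚᵘ (ℚᵘ.mkℚᵘ (ℤ.+ m) 0) ⟨
  ℚ.toℚᵘ (ℤ.+ m ℚ./ 1)                                 ∎)
  where
  open import Relation.Binary.Reasoning.Setoid ℚᵘ.≃-setoid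
  eq : (ℤ.+ 1 ℤ.* ℤ.+ (7 * m)) ℤ.* ℤ.+ 1 ≡ ℤ.+ m ℤ.* ℤ.+ 7
  eq = trans (ℤ.*-identityʳ _) (trans (ℤ.*-identityˡ _)
         (trans (cong ℤ.+_ (ℕ.*-comm 7 m)) (ℤ.pos-* m 7)))

-- The inequality holds for every approximation: `s k` is an integer cube root of n²(k+1)³, which is
-- at most the cube of 7m(k+1).
two-thirds-bound : ∀ n m → Sufficient n m → fromℚ seventh *ℝ (n ^⅔) ≤ℝ fromℕ m
two-thirds-bound n m h = _≼_.holds (≼-pointwise {fromℚ seventh *ℝ (n ^⅔)} {fromℕ m} λ k →
  ℚ.≤-trans (ℚ.*-monoˡ-≤-nonNeg seventh (/-mono-≤ (s k) (7 * m) k 0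
              (ℕ.≤-trans (ℕ.≤-reflexive (ℕ.*-identityʳ (s k))) (s-bound k))))
            (ℚ.≤-reflexive (seventh-* m)))
  where
  s : ℕ → ℕ
  s k = ⌊∛ (n ^ 2) * suc k ^ 3 ⌋
  s-bound : ∀ k → s k ≤ 7 * m * suc k
  s-bound k = ℕ.≮⇒≥ λ lt → ℕ.<⇒≱ (ℕ.^-monoˡ-< 3 lt) (begin
    s k ^ 3                 ≤⟨ proj₁ (proj₂ (cbrt (n ^ 2 * suc k ^ 3))) ⟩
    n ^ 2 * suc k ^ 3       ≤⟨ ℕ.*-monoˡ-≤ (suc k ^ 3)
                               (ℕ.≤-trans (ℕ.≤-reflexive (cong (n *_) (ℕ.*-identityʳ n))) h) ⟩
    (7 * m) ^ 3 * suc k ^ 3 ≡⟨ cube-* (7 * m) (suc k) ⟨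
    (7 * m * suc k) ^ 3     ∎)
    where open ℕ.≤-Reasoning

-- Transfer to finite metric spaces.

two-points : ∀ {n} → 2 ≤ n → ∃₂ λ (x y : Fin n) → x ≢ y
two-points (s≤s (s≤s _)) = zero , suc zero , λ ()

¬¬-∀ : ∀ {n} {P : Fin n → Set} → (∀ i → ¬ ¬ P i) → ¬ ¬ (∀ i → P i)
¬¬-∀ = sequence (RawMonad.rawApplicative ¬¬-Monad)

from-injective : ∀ {V : Set} {n} (V↔Fin : V ↔ Fin n) {i j} →
                 Inverse.from V↔Fin i ≡ Inverse.from V↔Fin j → i ≡ j
from-injective V↔Fin {i} {j} eq =
  trans (sym (strictlyInverseˡ i)) (trans (cong to eq) (strictlyInverseˡ j))
  where open Inverse V↔Fin

module Transport {V : Set} {n : ℕ} (V↔Fin : V ↔ Fin n)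
  (lineOf : V → V → Pred V 0ℓ) (β : Betweenness (Fin n))
  (∈-line⁺ : ∀ {p a b} → Betweenness._∈ℓ_ β p (a , b) →
     lineOf (Inverse.from V↔Fin a) (Inverse.from V↔Fin b) (Inverse.from V↔Fin p))
  (∈-line⁻ : ∀ {p a b} → lineOf (Inverse.from V↔Fin a) (Inverse.from V↔Fin b) (Inverse.from V↔Fin p) →
     Betweenness._∈ℓ_ β p (a , b))
  (B? : ∀ a b c → Dec (Betweenness.B β a b c)) (extremal : Betweenness.Extremal β)
  (2≤n : 2 ≤ n) where

  open Inverse V↔Fin using (to; from)
  open Betweenness β

  Line : Pred V 0ℓ → Set
  Line L = ∃₂ λ a b → a ≢ b × L ≐ lineOf a b

  module _ (nonuniversal : ¬ Line Unary.U) (m₀ : ℕ) (least : ∀ m → Sufficient n m → m₀ ≤ m) where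

    -- Membership is decidable here, so over finitely many points the failure of universality yields
    -- an explicit missing point.
    off-line : ∀ {a b} → a ≢ b → ∃ λ z → ¬ z ∈ℓ (a , b)
    off-line {a} {b} a≢b = ¬∀⟶∃¬ n (_∈ℓ (a , b)) (λ p → B? p a b ⊎-dec (B? a p b ⊎-dec B? a b p))
      λ all → nonuniversal (from a , from b , (λ eq → a≢b (from-injective V↔Fin eq)) ,
        (λ {x} _ → subst (lineOf (from a) (from b)) (Inverse.strictlyInverseʳ V↔Fin x) (∈-line⁺ (all (to x)))) ,
        λ _ → tt)

    Family : Set₁
    Family = ∃ λ (L : Fin m₀ → Pred V 0ℓ) → (∀ i → Line (L i)) × (∀ i j → i ≢ j → ¬ (L i ≐ L j))

    module _ {x y : Fin n} (x≢y : x ≢ y) where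
      open Lines β B? off-line extremal x≢y using (Pair; Same; many-lines)

      family : (∃ λ m → Sufficient n m × ∃ λ (rep : Fin m → Pair) →
        (∀ i → proj₁ (rep i) ≢ proj₂ (rep i)) × (∀ i j → i ≢ j → ¬ Same (rep i) (rep j))) → Family
      family (m , bound , rep , proper , distinct) =
        (λ i → lineOf (from (proj₁ (rep (ι i)))) (from (proj₂ (rep (ι i))))) ,
        (λ i → _ , _ , (λ eq → proper (ι i) (from-injective V↔Fin eq)) , ≐-refl) ,
        λ i j i≢j (Lᵢ⊆Lⱼ , Lⱼ⊆Lᵢ) → distinct (ι i) (ι j)
          (λ eq → i≢j (inject≤-injective m₀≤m m₀≤m i j eq))
          λ p → (λ p∈ → ∈-line⁻ (Lᵢ⊆Lⱼ (∈-line⁺ p∈))) , (λ p∈ → ∈-line⁻ (Lⱼ⊆Lᵢ (∈-line⁺ p∈)))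
        where
        m₀≤m = least m bound
        ι : Fin m₀ → Fin m
        ι i = inject≤ i m₀≤m

      distinct-lines-from : Family
      distinct-lines-from = family many-lines

    distinct-lines : Family
    distinct-lines = let (_ , _ , x≢y) = two-points 2≤n in distinct-lines-from x≢y

module FiniteMetric {V : Set} {n : ℕ} (V↔Fin : V ↔ Fin n) (ρ : V → V → ℝ) (metric : IsMetric ρ)
  (2≤n : 2 ≤ n) (nonuniversal : ¬ HasUniversalLine ρ) where

  open Inverse V↔Fin using (from)
  private module ρ = IsGeneralMetric metric

  d : Fin n → Fin n → ℝ
  d i j = ρ (from i) (from j)

  distance : IsDistance ℝ-monoid d
  distance = record
    { d-sym    = λ {a} {b} → ≈⇒≼ {d a b} {d b a} (ρ.sym (from a) (from b))
    ; d-refl   = λ {a} → ≈⇒≼ {d a a} {0ℝ} (ρ.≈⇒0 refl)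
    ; d-nonneg = λ {a} {b} → ⌈ ρ.nonNegative {from a} {from b} ⌉
    ; d-zero   = λ {a} {b} h → from-injective V↔Fin (ρ.0⇒≈ {from a} {from b}
        (≤ℝ-antisym {d a b} {0ℝ} (_≼_.holds h) (ρ.nonNegative {from a} {from b})))
    ; triangle = λ {a} {b} {c} → ⌈ ρ.triangle (from a) (from b) (from c) ⌉
    }

  open IsDistance distance using (Between; betweenness)
  open Betweenness betweenness using (_∈ℓ_)

  tight : ∀ {a b c} → Between a b c → d a c ≈ℝ d a b +ℝ d b c
  tight {a} {b} {c} h =
    ≤ℝ-antisym {d a c} {d a b +ℝ d b c} (ρ.triangle (from a) (from b) (from c)) (_≼_.holds h)

  loose : ∀ {a b c} → d a c ≈ℝ d a b +ℝ d b c → Between a b c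
  loose {a} {b} {c} = ≈⇒≽ {d a c} {d a b +ℝ d b c}

  ∈-line⁺ : ∀ {p a b} → p ∈ℓ (a , b) → line ρ (from a) (from b) (from p)
  ∈-line⁺ {p} {a} {b} (inj₁ h) = inj₁ (tight {p} {a} {b} h)
  ∈-line⁺ {p} {a} {b} (inj₂ (inj₁ h)) = inj₂ (inj₁ (tight {a} {p} {b} h))
  ∈-line⁺ {p} {a} {b} (inj₂ (inj₂ h)) = inj₂ (inj₂ (tight {a} {b} {p} h))

  ∈-line⁻ : ∀ {p a b} → line ρ (from a) (from b) (from p) → p ∈ℓ (a , b)
  ∈-line⁻ {p} {a} {b} (inj₁ h) = inj₁ (loose {p} {a} {b} h)
  ∈-line⁻ {p} {a} {b} (inj₂ (inj₁ h)) = inj₂ (inj₁ (loose {a} {p} {b} h))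
  ∈-line⁻ {p} {a} {b} (inj₂ (inj₂ h)) = inj₂ (inj₂ (loose {a} {b} {p} h))

  -- Only finitely many undecidable facts are used, a decision for each triple and a comparison for
  -- each quadruple of points, and double negation commutes with finite conjunctions.
  distinct-lines : ∀ m₀ → (∀ m → Sufficient n m → m₀ ≤ m) → ¬ ¬ HasDistinctLines ρ m₀
  distinct-lines m₀ least no-lines =
    ¬¬-∀ (λ a → ¬¬-∀ λ b → ¬¬-∀ λ c → ¬¬-excluded-middle) λ B? →
    ¬¬-∀ (λ a → ¬¬-∀ λ b → ¬¬-∀ λ c → ¬¬-∀ λ e → ≼-total (d a b) (d c e)) λ total →
    no-lines (Transport.distinct-lines V↔Fin (line ρ) betweenness
      (λ {p} {a} {b} → ∈-line⁺ {p} {a} {b}) (λ {p} {a} {b} → ∈-line⁻ {p} {a} {b})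
      B? (Diametral.extremal distance total) 2≤n nonuniversal m₀ least)

theorem1 : ∃[ c ] 0ℝ <ℝ c × (∃[ N ] 0 < N ×
    ((V : Set) (n : ℕ) → V ↔ Fin n →
    (ρ : V → V → ℝ) → IsMetric ρ →
    N ≤ n → ¬ HasUniversalLine ρ →
    ∃[ m ] (c *ℝ (n ^⅔) ≤ℝ fromℕ m) × ¬ ¬ HasDistinctLines ρ m))
theorem1 =
  -- The constant 1/7 comes from n² ≤ (7m)³; the threshold 2 provides two distinct points.
  fromℚ seventh , (seventh , ℚ.positive⁻¹ seventh , 0 , λ _ _ → ℚ.≤-reflexive (ℚ.+-identityˡ seventh)) ,
  2 , s≤s z≤n , λ V n V↔Fin ρ metric 2≤n nonuniversal →
  let (m₀ , sufficient , least) = least-sufficient n n (enough n) in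
  m₀ , two-thirds-bound n m₀ sufficient ,
  FiniteMetric.distinct-lines V↔Fin ρ metric 2≤n nonuniversal m₀ least
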